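{- Let $V$ be a real vector space, $X\subseteq V$, and $L:=Co(V,X)$. The following are equivalent: (i) $L$ is topologically scattered (as a subspace of $\mathbf{2}^X$ with the product topology); (ii) $L$ is order-scattered; (iii) the join-semilattice $S$ of compact elements of $L$ is order-scattered and has no join-subsemilattice isomorphic to $\mathcal{P}^{<\omega}(\mathbb{N})$; (iv) $X$ is contained in a finite union of lines of $V$, and for each such line $\ell$, equipped with an orientation, the linear order induced on the points of $X\cap \ell$ is order-scattered.
   Context: $Co(V,X)$ is the family of sets $C\cap X$ with $C$ a convex subset of $V$, ordered by inclusion; it is the lattice of closed sets of the closure $Y\mapsto \mathrm{conv}(Y)\cap X$ on $X$, and its compact elements are the sets $\mathrm{conv}(F)\cap X$ with $F\subseteq X$ finite. $\mathcal{P}^{<\omega}(\mathbb{N})$ is the join-semilattice (under union) of finite subsets of $\mathbb{N}$. A poset is order-scattered if it contains no copy of the chain $\mathbb{Q}$. A topological space is (topologically) scattered if every non-empty subset has an isolated point (in the induced topology); $Co(V,X)$ is viewed as a subset of $\mathbf{2}^X\cong\mathcal{P}(X)$ with the product of discrete two-point spaces.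
   Formalization: The vector space V is assumed to be nonzero: for V = {0} and X = {0}, conditions (i)–(iii) hold but V contains no line, so (iv) fails; the only other case excluded is V = {0} with X empty. -}

module Defs where

open import Algebra.Bundles using (CommutativeRing)
open import Algebra.Module.Bundles using (Module)
open import Data.Bool.Base using (Bool; true; false)
open import Data.List.Base using (List; _++_)
import Data.List.Membership.Setoid as ListMembership
open import Data.List.Membership.Propositional.Properties using (∈-++⁻)
open import Data.List.Relation.Binary.Subset.Propositional using (_⊆_)
open import Data.List.Relation.Binary.Subset.Propositional.Properties
  using (⊆-refl; ⊆-trans; xs⊆xs++ys; xs⊆ys++xs)
open import Data.List.Relation.Unary.All using (All)
open import Data.List.Relation.Unary.Any using (Any)
open import Data.Nat.Base using (ℕ)
open import Data.Product.Base using (Σ; ∃; _×_; _,_; proj₁; proj₂; swap)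
import Data.Rational.Base as ℚ
open ℚ using (ℚ)
open import Data.Sum.Base using ([_,_]′)
open import Function.Base using (_on_; _∘_)
open import Function.Bundles using (Func; _⟨$⟩_; _⇔_)
open import Function.Relation.Binary.Setoid.Equality using (_⇨_)
open import Level using (Level; _⊔_; 0ℓ) renaming (suc to lsuc)
open import Relation.Binary.Bundles using (Setoid; Poset)
open import Relation.Binary.Core using (Rel)
import Relation.Binary.Construct.On as On
open import Relation.Binary.Lattice.Bundles using (JoinSemilattice)
open import Relation.Binary.Morphism.Structures
  using (IsRelMonomorphism; IsOrderMonomorphism)
open import Relation.Binary.PropositionalEquality.Core
  using (_≡_; refl; sym; trans)
import Relation.Binary.PropositionalEquality.Properties as ≡
open import Relation.Binary.Structures using (IsTotalOrder)
open import Relation.Nullary.Negation.Core using (¬_)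
open import Relation.Unary using (Pred)

private
  variable
    a p q ℓ ℓ₁ ℓ₂ ℓ₃ ℓ₄ ℓ₅ : Level

------------------------------------------------------------------------
-- Subsets

-- Subsets of a setoid are characteristic functions, so 𝒫 A is literally
-- the set of points of 𝟐ᴬ.  Under excluded middle
-- every ≈-invariant predicate (of any universe level) has a
-- characteristic function, so this is the full power set.

𝒫 : Setoid a ℓ → Setoid (a ⊔ ℓ) a
𝒫 A = A ⇨ ≡.setoid Bool

Subset : Setoid a ℓ → Set (a ⊔ ℓ)
Subset A = Setoid.Carrier (𝒫 A)

module _ {A : Setoid a ℓ} where

  open Setoid A using (Carrier)

  infix 4 _∈_ _⊑_

  _∈_ : Carrier → Subset A → Set
  x ∈ Y = Y ⟨$⟩ x ≡ true

  _⊑_ : Subset A → Subset A → Set a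
  Y ⊑ Z = ∀ x → x ∈ Y → x ∈ Z

-- The set X, as a setoid in its own right.
⟦_⟧ : {A : Setoid a ℓ} → Subset A → Setoid a ℓ
⟦_⟧ {A = A} X = On.setoid A (proj₁ {B = _∈ X})

------------------------------------------------------------------------
-- Orders

module _ {A : Set a} (_≤_ : Rel A ℓ) where

  IsLub : Pred A p → A → Set (a ⊔ ℓ ⊔ p)
  IsLub D s = (∀ d → D d → d ≤ s) × (∀ u → (∀ d → D d → d ≤ u) → s ≤ u)

OrderScattered : {A : Set a} → Rel A ℓ₁ → Rel A ℓ₂ → Set (a ⊔ ℓ₁ ⊔ ℓ₂)
OrderScattered {A = A} _≈_ _≤_ =
  ¬ ∃ λ (f : ℚ → A) → IsOrderMonomorphism _≡_ _≈_ ℚ._≤_ _≤_ f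

module _ (P : Poset a ℓ₁ ℓ₂) where

  open Poset P
  open ListMembership Eq.setoid using () renaming (_∈_ to _∈ₗ_)

  OrderScatteredPoset : Set (a ⊔ ℓ₁ ⊔ ℓ₂)
  OrderScatteredPoset = OrderScattered _≈_ _≤_

  -- x ≤ ⋁ D implies x ≤ ⋁ F for some finite F ⊆ D.
  Compact : Pred Carrier (a ⊔ ℓ₁ ⊔ ℓ₂)
  Compact x = ∀ (D : Subset Eq.setoid) s → IsLub _≤_ (_∈ D) s → x ≤ s →
    ∃ λ (F : List Carrier) → All (_∈ D) F ×
    ∃ λ t → IsLub _≤_ (_∈ₗ F) t × x ≤ t

  compactElements : Poset (a ⊔ ℓ₁ ⊔ ℓ₂) ℓ₁ ℓ₂
  compactElements = On.poset P (proj₁ {B = Compact})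

  -- f x ∨ f y below is the join in P, expressed without assuming that
  -- all joins exist in P.
  HasJoinSubsemilattice : JoinSemilattice ℓ₃ ℓ₄ ℓ₅ → Set (a ⊔ ℓ₁ ⊔ ℓ₂ ⊔ ℓ₃ ⊔ ℓ₄)
  HasJoinSubsemilattice J = ∃ λ (f : J.Carrier → Carrier) →
    IsRelMonomorphism J._≈_ _≈_ f ×
    (∀ x y → f x ≤ f (x J.∨ y) × f y ≤ f (x J.∨ y) ×
      (∀ z → f x ≤ z → f y ≤ z → f (x J.∨ y) ≤ z))
    where module J = JoinSemilattice J

-- 𝒫^{<ω}(ℕ): lists up to having the same members, with union.
𝒫<ω : JoinSemilattice 0ℓ 0ℓ 0ℓ
𝒫<ω = record
  { Carrier = List ℕ
  ; _≈_     = λ xs ys → xs ⊆ ys × ys ⊆ xs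
  ; _≤_     = λ xs ys → xs ⊆ ys
  ; _∨_     = _++_
  ; isJoinSemilattice = record
    { isPartialOrder = record
      { isPreorder = record
        { isEquivalence = record
          { refl  = ⊆-refl , ⊆-refl
          ; sym   = swap
          ; trans = λ (f , f′) (g , g′) → ⊆-trans f g , ⊆-trans g′ f′
          }
        ; reflexive = proj₁
        ; trans     = ⊆-trans
        }
      ; antisym = _,_
      }
    ; supremum = λ xs ys →
        xs⊆xs++ys xs ys , xs⊆ys++xs ys xs ,
        λ zs xs⊆zs ys⊆zs → [ xs⊆zs , ys⊆zs ]′ ∘ ∈-++⁻ xs
    }
  }

------------------------------------------------------------------------
-- Topology of 𝟐ᴬ

module _ (A : Setoid a ℓ) where

  -- Product of discrete two-point spaces: a set is open when it contains,
  -- around each of its points, a cylinder fixing finitely many coordinates.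
  IsOpen : Subset (𝒫 A) → Set (a ⊔ ℓ)
  IsOpen U = ∀ f → f ∈ U →
    ∃ λ (F : List (Setoid.Carrier A)) →
    ∀ g → All (λ i → g ⟨$⟩ i ≡ f ⟨$⟩ i) F → g ∈ U

  TopScattered : Pred (Subset A) p → Set (a ⊔ ℓ ⊔ p)
  TopScattered L = (Y : Subset (𝒫 A)) → (∀ f → f ∈ Y → L f) → ∃ (_∈ Y) →
    ∃ λ f → ∃ λ (U : Subset (𝒫 A)) →
    IsOpen U × (∀ g → (g ∈ U × g ∈ Y) ⇔ Setoid._≈_ (𝒫 A) g f)

------------------------------------------------------------------------
-- The real numbers, characterised as a Dedekind-complete ordered field

record Reals c ℓ : Set (lsuc (c ⊔ ℓ)) where
  infix 4 _≤_
  field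
    commutativeRing : CommutativeRing c ℓ

  open CommutativeRing commutativeRing public

  field
    _≤_          : Rel Carrier ℓ
    isTotalOrder : IsTotalOrder _≈_ _≤_
    +-monoˡ-≤    : ∀ {x y} z → x ≤ y → x + z ≤ y + z
    *-nonNeg     : ∀ {x y} → 0# ≤ x → 0# ≤ y → 0# ≤ x * y
    0≉1          : ¬ 0# ≈ 1#
    invertible   : ∀ x → ¬ x ≈ 0# → ∃ λ y → x * y ≈ 1#
    complete     : ∀ (D : Subset setoid) → ∃ (_∈ D) →
                   (∃ λ u → ∀ d → d ∈ D → d ≤ u) → ∃ (IsLub _≤_ (_∈ D))

------------------------------------------------------------------------
-- Convexity and lines in a real vector space

module VectorSpace {r ℓr m ℓm} (ℝ : Reals r ℓr)
                   (V : Module (Reals.commutativeRing ℝ) m ℓm) where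

  open Reals ℝ using (0#; 1#; _+_; _≤_; _≈_) renaming (Carrier to Scalar)
  open Module V public using (Carrierᴹ; _≈ᴹ_; _+ᴹ_; _*ₗ_; 0ᴹ; ≈ᴹ-setoid)

  Convex : Subset ≈ᴹ-setoid → Set (r ⊔ ℓr ⊔ m)
  Convex C = ∀ x y → x ∈ C → y ∈ C →
    ∀ s t → 0# ≤ s → 0# ≤ t → s + t ≈ 1# → s *ₗ x +ᴹ t *ₗ y ∈ C

  record Line : Set (r ⊔ m ⊔ ℓm) where
    field
      point     : Carrierᴹ
      direction : Carrierᴹ
      nonzero   : ¬ direction ≈ᴹ 0ᴹ

  infix 4 _on-line_

  _on-line_ : Carrierᴹ → Line → Set (r ⊔ ℓm)
  x on-line l = ∃ λ t → x ≈ᴹ point +ᴹ t *ₗ direction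
    where open Line l

  -- An orientation of a line is given by any of its direction vectors; two
  -- of them give the same orientation iff they differ by a positive factor.
  record Orientation (l : Line) : Set (r ⊔ m ⊔ ℓm) where
    open Line l using (direction)
    field
      vector   : Carrierᴹ
      nonzero  : ¬ vector ≈ᴹ 0ᴹ
      parallel : ∃ λ t → vector ≈ᴹ t *ₗ direction

  module _ (X : Subset ≈ᴹ-setoid) where

    RelConvex : Pred (Subset ⟦ X ⟧) (r ⊔ ℓr ⊔ m ⊔ ℓm)
    RelConvex Y = ∃ λ (C : Subset ≈ᴹ-setoid) →
      Convex C × (∀ x → x ∈ Y ⇔ proj₁ x ∈ C)

    Co : Poset (r ⊔ ℓr ⊔ m ⊔ ℓm) m m
    Co = record
      { Carrier = Σ (Subset ⟦ X ⟧) RelConvex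
      ; _≈_     = Setoid._≈_ (𝒫 ⟦ X ⟧) on proj₁
      ; _≤_     = _⊑_ on proj₁
      ; isPartialOrder = record
        { isPreorder = record
          { isEquivalence = On.isEquivalence proj₁ (Setoid.isEquivalence (𝒫 ⟦ X ⟧))
          ; reflexive     = λ Y≈Z x x∈Y → trans (sym (Y≈Z x)) x∈Y
          ; trans         = λ Y⊑Z Z⊑W x x∈Y → Z⊑W x (Y⊑Z x x∈Y)
          }
        ; antisym = λ {Y} {Z} Y⊑Z Z⊑Y x →
            iff⇒≡ (proj₁ Y ⟨$⟩ x) (proj₁ Z ⟨$⟩ x) (Y⊑Z x) (Z⊑Y x)
        }
      }
      where
      iff⇒≡ : ∀ b c → (b ≡ true → c ≡ true) → (c ≡ true → b ≡ true) → b ≡ c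
      iff⇒≡ true        c           f g = sym (f refl)
      iff⇒≡ false  true        f g = g refl
      iff⇒≡ false  false  f g = refl

    Trace : Line → Set (r ⊔ m ⊔ ℓm)
    Trace l = ∃ λ x → x ∈ X × x on-line l

    module _ {l : Line} (o : Orientation l) where

      open Orientation o using (vector)

      infix 4 _≼_

      _≼_ : Rel (Trace l) (r ⊔ ℓr ⊔ ℓm)
      (x , _) ≼ (y , _) = ∃ λ t → 0# ≤ t × y ≈ᴹ x +ᴹ t *ₗ vector

      TraceOrderScattered : Set (r ⊔ ℓr ⊔ m ⊔ ℓm)
      TraceOrderScattered = OrderScattered {A = Trace l} (_≈ᴹ_ on proj₁) _≼_

    CoveredByScatteredLines : Set (r ⊔ ℓr ⊔ m ⊔ ℓm)
    CoveredByScatteredLines = ∃ λ (ls : List Line) →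
      (∀ x → x ∈ X → Any (x on-line_) ls) ×
      All (λ l → ∀ (o : Orientation l) → TraceOrderScattered o) ls

{-# OPTIONS --safe #-}

-- (i) ⇒ (ii): for a copy f of ℚ in L, the sets ⋃_{x < y} f x (y rational) form a
-- set without isolated points.  (ii) ⇒ (iii): a copy of 𝒫^{<ω}(ℕ) in S extends to
-- a copy of 𝒫(ℕ) ⊇ ℚ in L, by compactness.
--
-- (iii) ⇒ (iv): a copy f of ℚ in a line yields the chain conv {f 0, f x} (x > 0)
-- in S.  If no finite set of lines covers X, then X contains an infinite convexly
-- independent sequence, whose finite subsets generate a copy of 𝒫^{<ω}(ℕ).  That
-- sequence is linearly independent if X spans an infinite-dimensional space.
-- Otherwise start from points no three of which are collinear, and pass to
-- subsequences, one coordinate at a time: the first nonconstant coordinate t is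
-- made strictly monotone, and then every further coordinate s is strictly convex,
-- strictly concave or affine as a function of t, by Ramsey's theorem for the
-- slopes.  In the first two cases the points (t, s) are in convex position; if the
-- last one occurs for all coordinates the points are collinear.
--
-- (iv) ⇒ (i): given a set of members of L, take a line met by some member W, and
-- restrict to the members containing a fixed c ∈ W on it.  They cut the two rays
-- from c in initial segments.  If no member is isolated on a ray, then "separated
-- by a member" is a dense order on it, contradicting Cantor's theorem; otherwise
-- fix the finitely many coordinates isolating a member there, and continue with
-- the next ray.
module Submission where

open import Defs
open import Algebra.Bundles using (CommutativeMonoid; CommutativeRing; RawRing)
open import Algebra.Module.Bundles using (Module)
open import Algebra.Solver.Ring.AlmostCommutativeRing
  using (fromCommutativeRing; _-Raw-AlmostCommutative⟶_)
import Algebra.Solver.Ring as RingSolver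
open import Axiom.ExcludedMiddle using (ExcludedMiddle)
open import Data.Bool.Base using (Bool; true; false)
open import Data.Empty using (⊥-elim)
open import Data.Fin.Base using (Fin; zero; suc)
open import Data.Fin.Patterns using (0F; 1F; 2F; 3F; 4F; 5F)
import Data.Integer.Base as ℤ
open ℤ using (ℤ)
open import Data.List.Base using (List; []; _∷_; [_]; _++_; map; cartesianProductWith)
open import Data.List.Membership.Propositional using (lose) renaming (_∈_ to _∈ₗ_)
open import Data.List.Membership.Propositional.Properties
  using (∈-map⁺; ∈-map⁻; ∈-++⁻; ∈-cartesianProductWith⁺)
open import Data.List.Relation.Binary.Subset.Propositional using (_⊆_)
open import Data.List.Relation.Binary.Subset.Propositional.Properties
  using (xs⊆xs++ys; xs⊆ys++xs; map⁺)
open import Data.List.Relation.Unary.All as All using (All; []; _∷_)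
import Data.List.Relation.Unary.All.Properties as All
open import Data.List.Relation.Unary.Any as Any using (Any; here; there)
import Data.List.Relation.Unary.Any.Properties as Any
open import Data.Maybe.Base using (Maybe; just; nothing)
open import Data.Nat.Base as ℕ using (ℕ; zero; suc)
import Data.Nat.Properties as ℕ
open import Data.Product.Base
  using (∃; ∃₂; _×_; _,_; proj₁; proj₂; map₂; uncurry)
open import Data.Rational.Base as ℚ using (ℚ; mkℚ; 0ℚ; 1ℚ)
import Data.Rational.Properties as ℚ
open import Data.Sum.Base as Sum using (_⊎_; inj₁; inj₂; [_,_]′)
open import Data.Unit.Polymorphic.Base using (⊤; tt)
open import Data.Vec.Base as Vec using (Vec; []; _∷_; lookup)
open import Function.Base using (_∘_; id; _on_)
open import Function.Bundles using (Func; _⟨$⟩_; mk⇔; _⇔_; Equivalence)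
open import Level using (Level; _⊔_)
open import Relation.Binary.Bundles using (Setoid; Poset)
open import Relation.Binary.Core using (Rel; _⇒_)
open import Relation.Binary.Definitions using (Transitive; tri<; tri≈; tri>; _Respects_)
open import Relation.Binary.Morphism.Structures using (IsOrderMonomorphism; IsRelMonomorphism)
open import Relation.Binary.PropositionalEquality as ≡ using (_≡_; refl)
open import Relation.Binary.Structures using (IsEquivalence; IsTotalOrder)
open import Relation.Nullary.Decidable.Core using (Dec; does; yes; no; decidable-stable)
open import Relation.Nullary.Negation.Core using (¬_; contradiction)
open import Relation.Unary using (Pred; _∪_)

private
  variable
    a b ℓ ℓ₁ ℓ₂ p q r : Level

-- Enumerating pairs, integers and rationals

-- Enumeration of ℕ × ℕ along antidiagonals.
nextPair : ℕ × ℕ → ℕ × ℕ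
nextPair (m , zero)  = 0 , suc m
nextPair (m , suc n) = suc m , n

pair : ℕ → ℕ × ℕ
pair zero    = 0 , 0
pair (suc k) = nextPair (pair k)

-- Recursion on the antidiagonal, then on the first coordinate: `(0 , suc n)` is preceded by the end
-- `(n , 0)` of the antidiagonal before it.
pair-surjective : ∀ m n → ∃ λ k → pair k ≡ (m , n)
pair-surjective m n = go (m ℕ.+ n) m n refl
  where
  go : ∀ d m n → m ℕ.+ n ≡ d → ∃ λ k → pair k ≡ (m , n)
  go zero    zero    zero    _  = 0 , refl
  go (suc d) zero    (suc n) eq =
    let k , e = go d n 0 (≡.trans (ℕ.+-identityʳ n) (ℕ.suc-injective eq))
    in suc k , ≡.cong nextPair e
  go d       (suc m) n       eq =
    let k , e = go d m (suc n) (≡.trans (ℕ.+-suc m n) eq)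
    in suc k , ≡.cong nextPair e

enumℤ : ℕ → ℤ
enumℤ k = uncurry ℤ._⊖_ (pair k)

enumℤ-surjective : ∀ i → ∃ λ k → enumℤ k ≡ i
enumℤ-surjective (ℤ.+ n)    = map₂ (≡.cong (uncurry ℤ._⊖_)) (pair-surjective n 0)
enumℤ-surjective ℤ.-[1+ n ] = map₂ (≡.cong (uncurry ℤ._⊖_)) (pair-surjective 0 (suc n))

-- Unreduced fractions make values repeat, which is harmless: inserting a rational that the search
-- tree already finds changes nothing.
enumℚ : ℕ → ℚ
enumℚ k = enumℤ (proj₁ (pair k)) ℚ./ suc (proj₂ (pair k))

code : ∀ x → ∃ λ k → enumℚ k ≡ x
code x@(mkℚ n d-1 _) =
  let i , eᵢ = enumℤ-surjective n
      k , eₖ = pair-surjective i d-1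
  in k , ≡.trans (≡.cong (λ (i , d) → enumℤ i ℚ./ suc d) eₖ)
          (≡.trans (≡.cong (ℚ._/ suc d-1) eᵢ) (ℚ.↥p/↧p≡p x))

-- Copies of the rationals in dense orders

-- Cantor's theorem: the rationals, inserted one at a time into a binary search
-- tree whose leaves are the gaps still to be filled, embed in every dense order.
module Cantor {A : Set a} (_≺_ : Rel A ℓ) (≺-trans : Transitive _≺_)
              (dense : ∀ {x y} → x ≺ y → ∃ λ z → x ≺ z × z ≺ y) where

  data Tree (lo hi : A) : Set (a ⊔ ℓ) where
    leaf : lo ≺ hi → Tree lo hi
    node : ∀ (x : ℚ) z → Tree lo z → Tree z hi → Tree lo hi

  span : ∀ {lo hi} → Tree lo hi → lo ≺ hi
  span (leaf lt)      = lt
  span (node _ _ s t) = ≺-trans (span s) (span t)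

  -- Trees carry no ordering invariant on their keys. A search path records the comparisons made on
  -- the way instead, and monotonicity requires no more.
  data Found (x : ℚ) : ∀ {lo hi} → Tree lo hi → A → Set (a ⊔ ℓ) where
    here  : ∀ {lo hi z} {s : Tree lo z} {t : Tree z hi} → Found x (node x z s t) z
    left  : ∀ {lo hi y z v} {s : Tree lo z} {t : Tree z hi} → x ℚ.< y →
            Found x s v → Found x (node y z s t) v
    right : ∀ {lo hi y z v} {s : Tree lo z} {t : Tree z hi} → y ℚ.< x →
            Found x t v → Found x (node y z s t) v

  found-above : ∀ {x lo hi v} {t : Tree lo hi} → Found x t v → lo ≺ v
  found-above (here {s = s})        = span s
  found-above (left _ f)            = found-above f
  found-above (right {s = s} _ f)   = ≺-trans (span s) (found-above f)

  found-below : ∀ {x lo hi v} {t : Tree lo hi} → Found x t v → v ≺ hi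
  found-below (here {t = t})        = span t
  found-below (left {t = t} _ f)    = ≺-trans (found-below f) (span t)
  found-below (right _ f)           = found-below f

  -- The two search paths part at some node. Its value separates the two found values or is one of
  -- them; any other way of parting contradicts x < y.
  found-mono : ∀ {x y lo hi v w} {t : Tree lo hi} →
    Found x t v → Found y t w → x ℚ.< y → v ≺ w
  found-mono here        here        x<y = contradiction x<y (ℚ.<-irrefl refl)
  found-mono here        (left y<x _) x<y = contradiction x<y (ℚ.<-asym y<x)
  found-mono here        (right _ g) x<y = found-above g
  found-mono (left _ f)  here        x<y = found-below f
  found-mono (left _ f)  (left _ g)  x<y = found-mono f g x<y
  found-mono (left _ f)  (right _ g) x<y = ≺-trans (found-below f) (found-above g)
  found-mono (right y<x _) here      x<y = contradiction x<y (ℚ.<-asym y<x)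
  found-mono (right z<x _) (left y<z _) x<y = contradiction x<y (ℚ.<-asym (ℚ.<-trans y<z z<x))
  found-mono (right _ f) (right _ g) x<y = found-mono f g x<y

  insert : ∀ {lo hi} → ℚ → Tree lo hi → Tree lo hi
  insert x (leaf lt) = let z , lz , zh = dense lt in node x z (leaf lz) (leaf zh)
  insert x (node y z s t) with ℚ.<-cmp x y
  ... | tri< _ _ _ = node y z (insert x s) t
  ... | tri≈ _ _ _ = node y z s t
  ... | tri> _ _ _ = node y z s (insert x t)

  insert-finds : ∀ {lo hi} x (t : Tree lo hi) → ∃ (Found x (insert x t))
  insert-finds x (leaf lt) = _ , here
  insert-finds x (node y z s t) with ℚ.<-cmp x y
  ... | tri< lt _ _    = map₂ (left lt) (insert-finds x s)
  ... | tri≈ _ refl _  = _ , here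
  ... | tri> _ _ gt    = map₂ (right gt) (insert-finds x t)

  insert-preserves : ∀ {lo hi x v} y (t : Tree lo hi) → Found x t v → Found x (insert y t) v
  insert-preserves y (node z _ s t) f with ℚ.<-cmp y z
  insert-preserves y (node z _ s t) here         | tri< _ _ _ = here
  insert-preserves y (node z _ s t) (left lt f)  | tri< _ _ _ = left lt (insert-preserves y s f)
  insert-preserves y (node z _ s t) (right gt f) | tri< _ _ _ = right gt f
  insert-preserves y (node z _ s t) f            | tri≈ _ _ _ = f
  insert-preserves y (node z _ s t) here         | tri> _ _ _ = here
  insert-preserves y (node z _ s t) (left lt f)  | tri> _ _ _ = left lt f
  insert-preserves y (node z _ s t) (right gt f) | tri> _ _ _ = right gt (insert-preserves y t f)

  module _ {lo hi : A} (lo≺hi : lo ≺ hi) where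

    tree : ℕ → Tree lo hi
    tree zero    = leaf lo≺hi
    tree (suc n) = insert (enumℚ n) (tree n)

    embed : ℚ → A
    embed x = proj₁ (insert-finds (enumℚ (proj₁ (code x))) (tree (proj₁ (code x))))

    persists : ∀ {x v m n} → m ℕ.≤′ n → Found x (tree m) v → Found x (tree n) v
    persists ℕ.≤′-refl                     f = f
    persists {n = suc n} (ℕ.≤′-step m≤n) f = insert-preserves (enumℚ n) (tree n) (persists m≤n f)

    embed-found : ∀ x → Found x (tree (suc (proj₁ (code x)))) (embed x)
    embed-found x = ≡.subst (λ y → Found y (tree (suc k)) (embed x)) (proj₂ (code x))
      (proj₂ (insert-finds (enumℚ k) (tree k)))
      where k = proj₁ (code x)

    -- A value once assigned is never revised, so both values can be compared in the tree of the
    -- later stage.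
    embed-mono : ∀ {x y} → x ℚ.< y → embed x ≺ embed y
    embed-mono {x} {y} = found-mono
      (persists (ℕ.≤⇒≤′ (ℕ.m≤m⊔n m n)) (embed-found x))
      (persists (ℕ.≤⇒≤′ (ℕ.m≤n⊔m m n)) (embed-found y))
      where
      m = suc (proj₁ (code x))
      n = suc (proj₁ (code y))

  cantor : (∃₂ λ x y → x ≺ y) → ∃ λ (f : ℚ → A) → ∀ {x y} → x ℚ.< y → f x ≺ f y
  cantor (_ , _ , x≺y) = embed x≺y , embed-mono x≺y

-- Classical reasoning and subsets defined by predicates

module Classical (em : ∀ {ℓ} → ExcludedMiddle ℓ) where

  byContradiction : {P : Set p} → ¬ ¬ P → P
  byContradiction = decidable-stable em

  ¬∀⇒∃¬ : {A : Set a} {P : Pred A p} → ¬ (∀ x → P x) → ∃ λ x → ¬ P x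
  ¬∀⇒∃¬ ¬∀ = byContradiction λ ¬∃ → ¬∀ λ x → byContradiction λ ¬p → ¬∃ (x , ¬p)

  module _ (A : Setoid a ℓ) where

    open Setoid A using (Carrier; _≈_; sym)

    Invariant : Pred Carrier p → Set _
    Invariant P = ∀ x y → x ≈ y → P x → P y

    comprehension : (P : Pred Carrier p) → Invariant P → Subset A
    comprehension P resp = record
      { to   = λ x → does (em {P = P x})
      ; cong = λ {x} {y} x≈y → does-cong (resp x y x≈y) (resp y x (sym x≈y)) em em
      }
      where
      does-cong : ∀ {B : Set b} {C : Set r} → (B → C) → (C → B) →
        (B? : Dec B) (C? : Dec C) → does B? ≡ does C?
      does-cong f g (yes _) (yes _) = refl
      does-cong f g (no _)  (no _)  = refl
      does-cong f g (yes u) (no ¬v) = contradiction (f u) ¬v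
      does-cong f g (no ¬u) (yes v) = contradiction (g v) ¬u

    module _ (P : Pred Carrier p) (resp : Invariant P) where

      ∈-comprehension⁺ : ∀ x → P x → x ∈ comprehension P resp
      ∈-comprehension⁺ x px with em {P = P x}
      ... | yes _  = refl
      ... | no ¬px = contradiction px ¬px

      ∈-comprehension⁻ : ∀ x → x ∈ comprehension P resp → P x
      ∈-comprehension⁻ x eq with em {P = P x}
      ∈-comprehension⁻ x _  | yes px = px
      ∈-comprehension⁻ x () | no _

∈-resp : {A : Setoid a ℓ} (Y : Subset A) → (_∈ Y) Respects (Setoid._≈_ A)
∈-resp Y x≈y x∈Y = ≡.trans (≡.sym (Func.cong Y x≈y)) x∈Y

iff⇒≡ : ∀ {u v} → (u ≡ true → v ≡ true) → (v ≡ true → u ≡ true) → u ≡ v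
iff⇒≡ {true}         f g = ≡.sym (f refl)
iff⇒≡ {false} {true}  f g = g refl
iff⇒≡ {false} {false} f g = refl

-- Subsequences and Ramsey arguments

Increasing : (ℕ → ℕ) → Set
Increasing g = ∀ {i j} → i ℕ.< j → g i ℕ.< g j

step⇒increasing : ∀ {g} → (∀ n → g n ℕ.< g (suc n)) → Increasing g
step⇒increasing {g} step = λ i<j → go (ℕ.≤⇒≤′ i<j)
  where
  go : ∀ {i j} → suc i ℕ.≤′ j → g i ℕ.< g j
  go ℕ.≤′-refl      = step _
  go (ℕ.≤′-step lt) = ℕ.<-trans (go lt) (step _)

increasing-cancel-< : ∀ {g i j} → Increasing g → g i ℕ.< g j → i ℕ.< j
increasing-cancel-< {g} {i} {j} inc lt with ℕ.<-cmp i j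
... | tri< i<j _ _  = i<j
... | tri≈ _ refl _ = contradiction lt (ℕ.<-irrefl refl)
... | tri> _ _ j<i  = contradiction lt (ℕ.<-asym (inc j<i))

Subsequence : Set
Subsequence = ∃ Increasing

infix 10 _‼_
_‼_ : Subsequence → ℕ → ℕ
_‼_ = proj₁

shift : ℕ → Subsequence
shift n = (n ℕ.+_) , ℕ.+-monoʳ-< n

infixr 9 _⊚_
_⊚_ : Subsequence → Subsequence → Subsequence
(g , g-inc) ⊚ (h , h-inc) = g ∘ h , g-inc ∘ h-inc

module Ramsey (em : ∀ {ℓ} → ExcludedMiddle ℓ) where

  open Classical em

  infinitely-often : {P : Pred ℕ p} → (∀ N → ∃ λ n → N ℕ.≤ n × P n) →
    ∃ λ (g : Subsequence) → ∀ n → P (g ‼ n)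
  infinitely-often {P = P} pick =
    (g , step⇒increasing λ n → proj₁ (proj₂ (pick (suc (g n))))) , holds
    where
    g : ℕ → ℕ
    g zero    = proj₁ (pick 0)
    g (suc n) = proj₁ (pick (suc (g n)))
    holds : ∀ n → P (g n)
    holds zero    = proj₂ (proj₂ (pick 0))
    holds (suc n) = proj₂ (proj₂ (pick (suc (g n))))

  -- If `P` holds at arbitrarily large indices, these form the subsequence; otherwise `Q` holds on a
  -- tail where `P` fails.
  pigeonhole : {P : Pred ℕ p} {Q : Pred ℕ q} → (∀ n → P n ⊎ Q n) →
    ∃ λ (g : Subsequence) → (∀ n → P (g ‼ n)) ⊎ (∀ n → Q (g ‼ n))
  pigeonhole {P = P} {Q} split with em {P = ∀ N → ∃ λ n → N ℕ.≤ n × P n}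
  ... | yes often = map₂ inj₁ (infinitely-often often)
  ... | no  rare  =
    let N , never = ¬∀⇒∃¬ rare
    in shift N , inj₂ λ n → [ (λ pn → contradiction (_ , ℕ.m≤m+n N n , pn) never) , id ]′ (split (N ℕ.+ n))

  pigeonhole₃ : {P : Pred ℕ p} {Q : Pred ℕ q} {R : Pred ℕ r} → (∀ n → P n ⊎ Q n ⊎ R n) →
    ∃ λ (g : Subsequence) → (∀ n → P (g ‼ n)) ⊎ (∀ n → Q (g ‼ n)) ⊎ (∀ n → R (g ‼ n))
  pigeonhole₃ split with pigeonhole split
  ... | g , inj₁ all = g , inj₁ all
  ... | g , inj₂ or  with pigeonhole or
  ...   | h , all = g ⊚ h , inj₂ all

  module _ (Good : ℕ → (ℕ → ℕ) → Set p)
           (thin : ∀ {n s t} (h : Subsequence) → (∀ m → t m ≡ s (h ‼ m)) → Good n s → Good n t)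
           (refine : ∀ n (s : Subsequence) → ∃ λ (h : Subsequence) → Good n ((s ⊚ h) ‼_)) where

    private
      next : Subsequence → Subsequence
      next s = (s ⊚ shift 1) ⊚ proj₁ (refine (s ‼ 0) (s ⊚ shift 1))

      stage : ℕ → Subsequence
      stage zero    = id , id
      stage (suc n) = next (stage n)

      stage-+ : ∀ n m k → ∃ λ j → stage (n ℕ.+ m) ‼ k ≡ stage n ‼ j
      stage-+ n zero    k = k , ≡.cong (λ i → stage i ‼ k) (ℕ.+-identityʳ n)
      stage-+ n (suc m) k =
        let s     = stage (n ℕ.+ m)
            j , e = stage-+ n m _
        in j , ≡.trans (≡.cong (λ i → stage i ‼ k) (ℕ.+-suc n m)) e

      diag : ℕ → ℕ
      diag n = stage n ‼ 0

      diag-increasing : Increasing diag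
      diag-increasing = step⇒increasing λ n → proj₂ (stage n) (ℕ.s≤s ℕ.z≤n)

    -- Each stage splits off its first index and thins the rest until it is good for that index.
    -- Beyond entry n, the diagonal of first indices runs inside stage n + 1, so thinning transfers
    -- the goodness.
    diagonal : ∃ λ (g : Subsequence) → ∀ n → Good (g ‼ n) (λ m → g ‼ (suc n ℕ.+ m))
    diagonal = (diag , diag-increasing) , λ n →
      thin
        -- Positions of the diagonal within stage n + 1. They increase because both the diagonal and
        -- the stage do.
        ( (λ m → proj₁ (stage-+ (suc n) m 0))
        , λ {i} {j} i<j → increasing-cancel-< (proj₂ (stage (suc n)))
            (≡.subst₂ ℕ._<_ (proj₂ (stage-+ (suc n) i 0)) (proj₂ (stage-+ (suc n) j 0))
              (diag-increasing (ℕ.+-monoʳ-< (suc n) i<j))))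
        (λ m → proj₂ (stage-+ (suc n) m 0))
        (proj₂ (refine (stage n ‼ 0) (stage n ⊚ shift 1)))

after : {P : Pred ℕ p} {i : ℕ} → (∀ m → P (suc i ℕ.+ m)) → ∀ {j} → i ℕ.< j → P j
after {P = P} {i} all {j} i<j = ≡.subst P (ℕ.m+[n∸m]≡n i<j) (all (j ℕ.∸ suc i))

-- Normalisation in commutative rings and modules

-- A formal difference (m , n) of naturals denotes m × 1# - n × 1#; these are
-- the coefficients, with decidable equality, of the ring solver.
module DifferenceCoefficients {c ℓ} (R : CommutativeRing c ℓ) where

  open CommutativeRing R
  open import Algebra.Properties.Semiring.Mult semiring
    using () renaming (_×_ to _·_; ×-homo-+ to ·-homo-+; ×1-homo-* to ·1-homo-*)
  open import Algebra.Properties.Ring ring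
    using (-‿distribˡ-*; -‿distribʳ-*)
  open import Algebra.Properties.AbelianGroup +-abelianGroup
    using () renaming (⁻¹-∙-comm to -‿+-comm; ⁻¹-anti-homo‿- to -‿anti-homo--; ε⁻¹≈ε to -0#≈0#)
  open import Algebra.Properties.CommutativeSemigroup +-commutativeSemigroup
    using (interchange)
  open import Relation.Binary.Reasoning.Setoid setoid

  infix 9 ⌊_⌋
  ⌊_⌋ : ℕ → Carrier
  ⌊ n ⌋ = n · 1#

  ⟦_⟧ᶜ : ℕ × ℕ → Carrier
  ⟦ m , n ⟧ᶜ = ⌊ m ⌋ - ⌊ n ⌋

  coefficients : RawRing _ _
  coefficients = record
    { Carrier = ℕ × ℕ
    ; _≈_ = _≡_
    ; _+_ = λ (a , b) (c , d) → a ℕ.+ c , b ℕ.+ d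
    ; _*_ = λ (a , b) (c , d) → a ℕ.* c ℕ.+ b ℕ.* d , a ℕ.* d ℕ.+ b ℕ.* c
    ; -_  = λ (a , b) → b , a
    ; 0#  = 0 , 0
    ; 1#  = 1 , 0
    }

  [w+x]-[y+z] : ∀ w x y z → (w + x) - (y + z) ≈ (w - y) + (x - z)
  [w+x]-[y+z] w x y z = begin
    (w + x) - (y + z)     ≈⟨ +-congˡ (-‿+-comm y z) ⟨
    (w + x) + (- y - z)   ≈⟨ interchange w x (- y) (- z) ⟩
    (w - y) + (x - z)     ∎

  [w-x]*[y-z] : ∀ w x y z → (w * y + x * z) - (w * z + x * y) ≈ (w - x) * (y - z)
  [w-x]*[y-z] w x y z = begin
    (w * y + x * z) - (w * z + x * y)                 ≈⟨ [w+x]-[y+z] (w * y) (x * z) (w * z) (x * y) ⟩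
    (w * y - w * z) + (x * z - x * y)                 ≈⟨ +-cong (+-congˡ (-‿distribʳ-* w z)) (sym (-‿anti-homo-- (x * y) (x * z))) ⟩
    (w * y + w * - z) + - (x * y - x * z)             ≈⟨ +-congˡ (-‿cong (+-congˡ (-‿distribʳ-* x z))) ⟩
    (w * y + w * - z) + - (x * y + x * - z)           ≈⟨ +-cong (distribˡ w y (- z)) (-‿cong (distribˡ x y (- z))) ⟨
    w * (y - z) + - (x * (y - z))                     ≈⟨ +-congˡ (-‿distribˡ-* x (y - z)) ⟩
    w * (y - z) + - x * (y - z)                       ≈⟨ distribʳ (y - z) w (- x) ⟨
    (w - x) * (y - z)                                 ∎

  ⌊⌋-homo-+* : ∀ a b c d → ⌊ a ℕ.* c ℕ.+ b ℕ.* d ⌋ ≈ ⌊ a ⌋ * ⌊ c ⌋ + ⌊ b ⌋ * ⌊ d ⌋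
  ⌊⌋-homo-+* a b c d =
    trans (·-homo-+ 1# (a ℕ.* c) (b ℕ.* d)) (+-cong (·1-homo-* a c) (·1-homo-* b d))

  morphism : coefficients -Raw-AlmostCommutative⟶ fromCommutativeRing R
  morphism = record
    { ⟦_⟧    = ⟦_⟧ᶜ
    ; +-homo = λ (a , b) (c , d) →
        trans (+-cong (·-homo-+ 1# a c) (-‿cong (·-homo-+ 1# b d)))
              ([w+x]-[y+z] ⌊ a ⌋ ⌊ c ⌋ ⌊ b ⌋ ⌊ d ⌋)
    ; *-homo = λ (a , b) (c , d) →
        trans (+-cong (⌊⌋-homo-+* a b c d) (-‿cong (⌊⌋-homo-+* a b d c)))
              ([w-x]*[y-z] ⌊ a ⌋ ⌊ b ⌋ ⌊ c ⌋ ⌊ d ⌋)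
    ; -‿homo = λ (a , b) → sym (-‿anti-homo-- ⌊ a ⌋ ⌊ b ⌋)
    ; 0-homo = -‿inverseʳ 0#
    ; 1-homo = trans (+-cong (+-identityʳ 1#) -0#≈0#) (+-identityʳ 1#)
    }

  -- Cross-addition compares the integers a - b and c - d inside ℕ. Failure claims nothing, as
  -- different integers may coincide in the ring.
  difference-≟ : ∀ p q → Maybe (⟦ p ⟧ᶜ ≈ ⟦ q ⟧ᶜ)
  difference-≟ (a , b) (c , d) with a ℕ.+ d ℕ.≟ c ℕ.+ b
  ... | no _  = nothing
  ... | yes e = just (begin
    ⌊ a ⌋ - ⌊ b ⌋                        ≈⟨ +-identityʳ _ ⟨
    (⌊ a ⌋ - ⌊ b ⌋) + 0#                 ≈⟨ +-congˡ (-‿inverseʳ ⌊ d ⌋) ⟨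
    (⌊ a ⌋ - ⌊ b ⌋) + (⌊ d ⌋ - ⌊ d ⌋)    ≈⟨ [w+x]-[y+z] ⌊ a ⌋ ⌊ d ⌋ ⌊ b ⌋ ⌊ d ⌋ ⟨
    (⌊ a ⌋ + ⌊ d ⌋) - (⌊ b ⌋ + ⌊ d ⌋)    ≈⟨ +-cong (·-homo-+ 1# a d) refl′ ⟨
    ⌊ a ℕ.+ d ⌋ - (⌊ b ⌋ + ⌊ d ⌋)        ≡⟨ ≡.cong (λ n → ⌊ n ⌋ - (⌊ b ⌋ + ⌊ d ⌋)) e ⟩
    ⌊ c ℕ.+ b ⌋ - (⌊ b ⌋ + ⌊ d ⌋)        ≈⟨ +-cong (·-homo-+ 1# c b) (-‿cong (+-comm ⌊ b ⌋ ⌊ d ⌋)) ⟩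
    (⌊ c ⌋ + ⌊ b ⌋) - (⌊ d ⌋ + ⌊ b ⌋)    ≈⟨ [w+x]-[y+z] ⌊ c ⌋ ⌊ b ⌋ ⌊ d ⌋ ⌊ b ⌋ ⟩
    (⌊ c ⌋ - ⌊ d ⌋) + (⌊ b ⌋ - ⌊ b ⌋)    ≈⟨ +-congˡ (-‿inverseʳ ⌊ b ⌋) ⟩
    (⌊ c ⌋ - ⌊ d ⌋) + 0#                 ≈⟨ +-identityʳ _ ⟩
    ⌊ c ⌋ - ⌊ d ⌋                        ∎)
    where refl′ = CommutativeRing.refl R

  open RingSolver coefficients (fromCommutativeRing R) morphism difference-≟ public
    using (Polynomial; op; con; var; _:+_; _:*_; :-_; _:-_; _:=_; solve; prove; ⟦_⟧↓)
    renaming (⟦_⟧ to ⟦_⟧ₚ)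

  -- The constants of the solver evaluate to `0# - 0#` and `1# + 0# - 0#`, not to `0#` and `1#`.
  -- Goals that mention a constant are converted with this equation and the next.
  ⟦0⟧≈0 : ⟦ 0 , 0 ⟧ᶜ ≈ 0#
  ⟦0⟧≈0 = -‿inverseʳ 0#

  ⟦1⟧≈1 : ⟦ 1 , 0 ⟧ᶜ ≈ 1#
  ⟦1⟧≈1 = _-Raw-AlmostCommutative⟶_.1-homo morphism

  :0 :1 : ∀ {k} → Polynomial k
  :0 = con (0 , 0)
  :1 = con (1 , 0)

module LinearSolver {r ℓr m ℓm} {R : CommutativeRing r ℓr} (V : Module R m ℓm) where

  open CommutativeRing R
  open Module V
  open DifferenceCoefficients R public
  open import Relation.Binary.Reasoning.Setoid ≈ᴹ-setoid
  open import Algebra.Properties.CommutativeSemigroup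
    (CommutativeMonoid.commutativeSemigroup +ᴹ-commutativeMonoid) using (interchange)

  infixr 7 _:•_
  infixl 6 _:⊕_

  data Combination (k n : ℕ) : Set where
    vec  : Fin n → Combination k n
    :0ᴹ  : Combination k n
    _:⊕_ : Combination k n → Combination k n → Combination k n
    _:•_ : Polynomial k → Combination k n → Combination k n

  module _ {k n : ℕ} (ρ : Vec Carrier k) (σ : Vec Carrierᴹ n) where

    ⟦_⟧ᴹ : Combination k n → Carrierᴹ
    ⟦ vec i  ⟧ᴹ = lookup σ i
    ⟦ :0ᴹ    ⟧ᴹ = 0ᴹ
    ⟦ e :⊕ f ⟧ᴹ = ⟦ e ⟧ᴹ +ᴹ ⟦ f ⟧ᴹ
    ⟦ p :• e ⟧ᴹ = ⟦ p ⟧ₚ ρ *ₗ ⟦ e ⟧ᴹ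

  unit : ∀ {k n} → Fin n → Vec (Polynomial k) n
  unit zero    = :1 ∷ Vec.replicate _ :0
  unit (suc i) = :0 ∷ unit i

  coords : ∀ {k n} → Combination k n → Vec (Polynomial k) n
  coords (vec i)  = unit i
  coords :0ᴹ      = Vec.replicate _ :0
  coords (e :⊕ f) = Vec.zipWith _:+_ (coords e) (coords f)
  coords (p :• e) = Vec.map (p :*_) (coords e)

  module _ {k : ℕ} (ρ : Vec Carrier k) where

    total : ∀ {n} → Vec (Polynomial k) n → Vec Carrierᴹ n → Carrierᴹ
    total []       []      = 0ᴹ
    total (p ∷ ps) (v ∷ σ) = ⟦ p ⟧ₚ ρ *ₗ v +ᴹ total ps σ

    total-0 : ∀ {n} (σ : Vec Carrierᴹ n) → total (Vec.replicate n :0) σ ≈ᴹ 0ᴹ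
    total-0 []      = ≈ᴹ-refl
    total-0 (v ∷ σ) = ≈ᴹ-trans
      (+ᴹ-cong (≈ᴹ-trans (*ₗ-cong ⟦0⟧≈0 ≈ᴹ-refl) (*ₗ-zeroˡ v)) (total-0 σ)) (+ᴹ-identityˡ 0ᴹ)

    total-unit : ∀ {n} i (σ : Vec Carrierᴹ n) → total (unit i) σ ≈ᴹ lookup σ i
    total-unit zero    (v ∷ σ) = ≈ᴹ-trans
      (+ᴹ-cong (≈ᴹ-trans (*ₗ-cong ⟦1⟧≈1 ≈ᴹ-refl) (*ₗ-identityˡ v)) (total-0 σ)) (+ᴹ-identityʳ v)
    total-unit (suc i) (v ∷ σ) = ≈ᴹ-trans
      (+ᴹ-cong (≈ᴹ-trans (*ₗ-cong ⟦0⟧≈0 ≈ᴹ-refl) (*ₗ-zeroˡ v)) (total-unit i σ)) (+ᴹ-identityˡ _)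

    total-+ : ∀ {n} ps qs (σ : Vec Carrierᴹ n) →
      total (Vec.zipWith _:+_ ps qs) σ ≈ᴹ total ps σ +ᴹ total qs σ
    total-+ []       []       []      = ≈ᴹ-sym (+ᴹ-identityˡ 0ᴹ)
    total-+ (p ∷ ps) (q ∷ qs) (v ∷ σ) = ≈ᴹ-trans
      (+ᴹ-cong (*ₗ-distribʳ v (⟦ p ⟧ₚ ρ) (⟦ q ⟧ₚ ρ)) (total-+ ps qs σ))
      (interchange (⟦ p ⟧ₚ ρ *ₗ v) (⟦ q ⟧ₚ ρ *ₗ v) (total ps σ) (total qs σ))

    total-* : ∀ {n} p qs (σ : Vec Carrierᴹ n) →
      total (Vec.map (p :*_) qs) σ ≈ᴹ ⟦ p ⟧ₚ ρ *ₗ total qs σ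
    total-* p []       []      = ≈ᴹ-sym (*ₗ-zeroʳ _)
    total-* p (q ∷ qs) (v ∷ σ) = ≈ᴹ-trans
      (+ᴹ-cong (*ₗ-assoc (⟦ p ⟧ₚ ρ) (⟦ q ⟧ₚ ρ) v) (total-* p qs σ))
      (≈ᴹ-sym (*ₗ-distribˡ (⟦ p ⟧ₚ ρ) (⟦ q ⟧ₚ ρ *ₗ v) (total qs σ)))

    total-coords : ∀ {n} (e : Combination k n) (σ : Vec Carrierᴹ n) →
      total (coords e) σ ≈ᴹ ⟦_⟧ᴹ ρ σ e
    total-coords (vec i)  σ = total-unit i σ
    total-coords :0ᴹ      σ = total-0 σ
    total-coords (e :⊕ f) σ = ≈ᴹ-trans (total-+ (coords e) (coords f) σ)
      (+ᴹ-cong (total-coords e σ) (total-coords f σ))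
    total-coords (p :• e) σ = ≈ᴹ-trans (total-* p (coords e) σ)
      (*ₗ-cong (CommutativeRing.refl R) (total-coords e σ))

    SameNormalForms : ∀ {n} → Vec (Polynomial k) n → Vec (Polynomial k) n → Set ℓr
    SameNormalForms []       []       = ⊤
    SameNormalForms (p ∷ ps) (q ∷ qs) = ⟦ p ⟧↓ ρ ≈ ⟦ q ⟧↓ ρ × SameNormalForms ps qs

    total-cong : ∀ {n} ps qs (σ : Vec Carrierᴹ n) → SameNormalForms ps qs →
      total ps σ ≈ᴹ total qs σ
    total-cong []       []       []      _        = ≈ᴹ-refl
    total-cong (p ∷ ps) (q ∷ qs) (v ∷ σ) (e , es) =
      +ᴹ-cong (*ₗ-cong (prove ρ p q e) ≈ᴹ-refl) (total-cong ps qs σ es)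

    -- The vectors are treated as formal generators, and an identity follows once the coefficients
    -- of each generator agree. `SameNormalForms` computes to a tuple of scalar equations, one per
    -- generator, each closed by `≈-refl` when the normal forms coincide.
    proveᴹ : ∀ {n} (σ : Vec Carrierᴹ n) (e f : Combination k n) →
      SameNormalForms (coords e) (coords f) → ⟦_⟧ᴹ ρ σ e ≈ᴹ ⟦_⟧ᴹ ρ σ f
    proveᴹ σ e f h = begin
      ⟦_⟧ᴹ ρ σ e          ≈⟨ total-coords e σ ⟨
      total (coords e) σ  ≈⟨ total-cong (coords e) (coords f) σ h ⟩
      total (coords f) σ  ≈⟨ total-coords f σ ⟩
      ⟦_⟧ᴹ ρ σ f          ∎

-- Arithmetic of the ordered field

module OrderedField (em : ∀ {ℓ} → ExcludedMiddle ℓ) {c ℓ} (ℝ : Reals c ℓ) where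

  open Reals ℝ public hiding (refl; sym; trans)
  open Reals ℝ public using () renaming (refl to ≈-refl; sym to ≈-sym; trans to ≈-trans)
  open DifferenceCoefficients commutativeRing
    using (⟦0⟧≈0; solve; _:+_; _:*_; _:-_; :-_; _:=_; :0; :1)
  open IsTotalOrder isTotalOrder public
    using ()
    renaming (reflexive to ≤-reflexive; trans to ≤-trans; antisym to ≤-antisym; total to ≤-total)

  infix 4 _<_

  _<_ : Rel Carrier ℓ
  x < y = ¬ y ≤ x

  <⇒≤ : ∀ {x y} → x < y → x ≤ y
  <⇒≤ {x} {y} x<y with ≤-total x y
  ... | inj₁ x≤y = x≤y
  ... | inj₂ y≤x = contradiction y≤x x<y

  <-≤-trans : ∀ {x y z} → x < y → y ≤ z → x < z
  <-≤-trans x<y y≤z z≤x = x<y (≤-trans y≤z z≤x)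

  <-trans : ∀ {x y z} → x < y → y < z → x < z
  <-trans x<y y<z = <-≤-trans x<y (<⇒≤ y<z)

  <⇒≉ : ∀ {x y} → x < y → ¬ x ≈ y
  <⇒≉ x<y x≈y = x<y (≤-reflexive (≈-sym x≈y))

  <-cmp : ∀ x y → x < y ⊎ y < x ⊎ x ≈ y
  <-cmp x y with em {P = y ≤ x} | em {P = x ≤ y}
  ... | no y≰x  | _       = inj₁ y≰x
  ... | yes _   | no x≰y  = inj₂ (inj₁ x≰y)
  ... | yes y≤x | yes x≤y = inj₂ (inj₂ (≤-antisym x≤y y≤x))

  ≤⇒0≤- : ∀ {x y} → x ≤ y → 0# ≤ y - x
  ≤⇒0≤- {x} x≤y = ≤-trans (≤-reflexive (≈-sym (-‿inverseʳ x))) (+-monoˡ-≤ (- x) x≤y)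

  0≤-⇒≤ : ∀ {x y} → 0# ≤ y - x → x ≤ y
  0≤-⇒≤ {x} {y} 0≤ = ≤-trans (≤-reflexive (≈-sym (+-identityˡ x)))
    (≤-trans (+-monoˡ-≤ x 0≤) (≤-reflexive (solve 2 (λ x y → (y :- x) :+ x := y) ≈-refl x y)))

  -- Most inequalities below are obtained in this way: the solver identifies a quantity known to be
  -- nonnegative with the difference of the two sides.
  difference-≤ : ∀ {x y d} → 0# ≤ d → d ≈ y - x → x ≤ y
  difference-≤ 0≤d d≈ = 0≤-⇒≤ (≤-trans 0≤d (≤-reflexive d≈))

  difference-< : ∀ {x y d} → 0# < d → d ≈ y - x → x < y
  difference-< {x} {y} 0<d d≈ y≤x = 0<d (difference-≤ (≤⇒0≤- y≤x)
    (≈-trans (solve 2 (λ x y → x :- y := :0 :- (y :- x)) ≈-refl x y)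
             (+-cong ⟦0⟧≈0 (-‿cong (≈-sym d≈)))))

  <⇒0<- : ∀ {x y} → x < y → 0# < y - x
  <⇒0<- {x} {y} x<y y-x≤0 = x<y (difference-≤ (≤⇒0≤- y-x≤0)
    (≈-trans (+-congʳ (≈-sym ⟦0⟧≈0)) (solve 2 (λ x y → :0 :- (y :- x) := x :- y) ≈-refl x y)))

  neg-mono-< : ∀ {x y} → x < y → - y < - x
  neg-mono-< {x} {y} x<y = difference-< (<⇒0<- x<y)
    (solve 2 (λ x y → y :- x := (:- x) :- (:- y)) ≈-refl x y)

  +-nonNeg : ∀ {x y} → 0# ≤ x → 0# ≤ y → 0# ≤ x + y
  +-nonNeg {x} {y} 0≤x 0≤y = ≤-trans 0≤y
    (≤-trans (≤-reflexive (≈-sym (+-identityˡ y))) (+-monoˡ-≤ y 0≤x))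

  0≤-x : ∀ {x} → x ≤ 0# → 0# ≤ - x
  0≤-x {x} x≤0 = ≤-trans (≤⇒0≤- x≤0) (≤-reflexive (+-identityˡ (- x)))

  -- If 1 ≤ 0, then 1 is the square of the nonnegative number -1.
  0≤1 : 0# ≤ 1#
  0≤1 with ≤-total 0# 1#
  ... | inj₁ 0≤1 = 0≤1
  ... | inj₂ 1≤0 = ≤-trans (*-nonNeg (0≤-x 1≤0) (0≤-x 1≤0))
    (≤-reflexive (≈-trans (solve 1 (λ x → (:- x) :* (:- x) := x :* x) ≈-refl 1#) (*-identityˡ 1#)))

  inverse-nonNeg : ∀ {x y} → 0# ≤ x → x * y ≈ 1# → 0# ≤ y
  inverse-nonNeg {x} {y} 0≤x xy≈1 with ≤-total 0# y
  ... | inj₁ 0≤y = 0≤y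
  ... | inj₂ y≤0 = ⊥-elim (0≉1 (≤-antisym 0≤1 (≤-trans (≤-reflexive (≈-sym xy≈1)) xy≤0)))
    where
    xy≤0 : x * y ≤ 0#
    xy≤0 = difference-≤ (*-nonNeg 0≤x (0≤-x y≤0))
      (≈-trans (solve 2 (λ x y → x :* (:- y) := :- (x :* y)) ≈-refl x y) (≈-sym (+-identityˡ _)))

  *-cancel-0 : ∀ {x y} → ¬ x ≈ 0# → x * y ≈ 0# → y ≈ 0#
  *-cancel-0 {x} {y} x≉0 xy≈0 =
    let z , xz≈1 = invertible x x≉0 in
    ≈-trans (≈-sym (*-identityʳ y)) (≈-trans (*-congˡ (≈-sym xz≈1))
      (≈-trans (solve 3 (λ x y z → y :* (x :* z) := z :* (x :* y)) ≈-refl x y z)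
        (≈-trans (*-congˡ xy≈0) (zeroʳ z))))

  *-pos : ∀ {x y} → 0# < x → 0# < y → 0# < x * y
  *-pos 0<x 0<y xy≤0 = <⇒≉ 0<y (≈-sym (*-cancel-0 (λ x≈0 → <⇒≉ 0<x (≈-sym x≈0))
    (≤-antisym xy≤0 (*-nonNeg (<⇒≤ 0<x) (<⇒≤ 0<y)))))

  *-cancelʳ-pos : ∀ {x y} → 0# < y → 0# < x * y → 0# < x
  *-cancelʳ-pos {x} {y} 0<y 0<xy x≤0 = 0<xy (difference-≤ (*-nonNeg (0≤-x x≤0) (<⇒≤ 0<y))
    (≈-trans (solve 2 (λ x y → (:- x) :* y := :- (x :* y)) ≈-refl x y) (≈-sym (+-identityˡ _))))

  -- A convex combination is at least the smaller of a and b.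
  convex-above : ∀ {a b s t z} → 0# ≤ s → 0# ≤ t → s + t ≈ 1# → z < a → z < b → z < s * a + t * b
  convex-above {a} {b} {s} {t} 0≤s 0≤t s+t≈1 z<a z<b with ≤-total a b
  ... | inj₁ a≤b = <-≤-trans z<a (difference-≤ (*-nonNeg 0≤t (≤⇒0≤- a≤b))
    (≈-trans (solve 4 (λ a b s t → t :* (b :- a) := (s :* a :+ t :* b) :- (s :+ t) :* a) ≈-refl a b s t)
             (+-congˡ (-‿cong (≈-trans (*-congʳ s+t≈1) (*-identityˡ a))))))
  ... | inj₂ b≤a = <-≤-trans z<b (difference-≤ (*-nonNeg 0≤s (≤⇒0≤- b≤a))
    (≈-trans (solve 4 (λ a b s t → s :* (a :- b) := (s :* a :+ t :* b) :- (s :+ t) :* b) ≈-refl a b s t)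
             (+-congˡ (-‿cong (≈-trans (*-congʳ s+t≈1) (*-identityˡ b))))))

-- Monotone and convex subsequences of scalars

module ScalarSequences (em : ∀ {ℓ} → ExcludedMiddle ℓ) {r ℓr} (ℝ : Reals r ℓr) where

  open OrderedField em ℝ
  open Ramsey em
  open DifferenceCoefficients commutativeRing using (solve; _:+_; _:*_; _:-_; :-_; _:=_)

  Monotone : Rel Carrier ℓr → (ℕ → Carrier) → Set ℓr
  Monotone _∼_ y = ∀ {i j} → i ℕ.< j → y i ∼ y j

  StrictlyIncreasing StrictlyDecreasing Constant : (ℕ → Carrier) → Set ℓr
  StrictlyIncreasing = Monotone _<_
  StrictlyDecreasing = Monotone λ x y → y < x
  Constant           = Monotone _≈_

  Trend : (ℕ → Carrier) → Set ℓr
  Trend y = StrictlyIncreasing y ⊎ StrictlyDecreasing y ⊎ Constant y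

  trend-thin : ∀ {y z : ℕ → Carrier} (h : Subsequence) → (∀ m → z m ≡ y (h ‼ m)) → Trend y → Trend z
  trend-thin {y} {z} (h , h-inc) z≡y = Sum.map (thin _<_) (Sum.map (thin λ x y → y < x) (thin _≈_))
    where
    thin : ∀ (_∼_ : Rel Carrier ℓr) → Monotone _∼_ y → Monotone _∼_ z
    thin _∼_ mono {i} {j} i<j = ≡.subst₂ _∼_ (≡.sym (z≡y i)) (≡.sym (z≡y j)) (mono (h-inc i<j))

  -- Ramsey's theorem for pairs, coloured by trichotomy: the diagonal subsequence makes the colour
  -- of a pair depend on its first entry only, and the pigeonhole principle then makes it constant.
  trend-subsequence : ∀ (y : ℕ → Carrier) → ∃ λ (g : Subsequence) → Trend (λ n → y (g ‼ n))
  trend-subsequence y =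
    let g , good = diagonal Good thin (λ a s → pigeonhole₃ λ n → <-cmp (y a) (y (s ‼ n)))
        h , all  = pigeonhole₃ good
    in g ⊚ h , Sum.map (assemble _<_ g h) (Sum.map (assemble (λ x y → y < x) g h) (assemble _≈_ g h)) all
    where
    Uniform : Rel Carrier ℓr → ℕ → (ℕ → ℕ) → Set ℓr
    Uniform _∼_ a s = ∀ m → y a ∼ y (s m)
    Good : ℕ → (ℕ → ℕ) → Set ℓr
    Good a s = Uniform _<_ a s ⊎ Uniform (λ x y → y < x) a s ⊎ Uniform _≈_ a s
    thin : ∀ {a s t} (h : Subsequence) → (∀ m → t m ≡ s (h ‼ m)) → Good a s → Good a t
    thin {a} {s} {t} h t≡s = Sum.map (along _<_) (Sum.map (along λ x y → y < x) (along _≈_))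
      where
      along : ∀ (_∼_ : Rel Carrier ℓr) → Uniform _∼_ a s → Uniform _∼_ a t
      along _∼_ all m = ≡.subst (λ i → y a ∼ y i) (≡.sym (t≡s m)) (all (h ‼ m))
    assemble : ∀ (_∼_ : Rel Carrier ℓr) (g h : Subsequence) →
      (∀ n → Uniform _∼_ (g ‼ (h ‼ n)) (λ m → g ‼ (suc (h ‼ n) ℕ.+ m))) → Monotone _∼_ (λ n → y ((g ⊚ h) ‼ n))
    assemble _∼_ g h all {i} i<j =
      after {P = λ k → y (g ‼ (h ‼ i)) ∼ y (g ‼ k)} (all i) (proj₂ h i<j)

  -- The points (t n , s n) of the plane are in strictly convex position, as witnessed by
  -- a line of slope μ through (t j , s j).
  Supported : (t s : ℕ → Carrier) → Set _
  Supported t s = ∀ j → ∃ λ μ → ∀ i → ¬ i ≡ j → s j - μ * t j < s i - μ * t i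

  Slopes : (t s : ℕ → Carrier) (σ : ℕ → ℕ → Carrier) → Set _
  Slopes t s σ = ∀ {i j} → i ℕ.< j → s j ≈ s i + σ i j * (t j - t i)

  double : Subsequence
  double = (λ n → n ℕ.+ n) , λ i<j → ℕ.+-mono-< i<j i<j

  -- The supporting slope at 2j is that of the chord from 2j to the skipped point 2j + 1.
  increasing-slopes⇒supported : ∀ {t s σ} → StrictlyIncreasing t → Slopes t s σ →
    (∀ i {j k} → i ℕ.< j → j ℕ.< k → σ i j < σ i k) →
    Supported (λ n → t (double ‼ n)) (λ n → s (double ‼ n))
  increasing-slopes⇒supported {t} {s} {σ} t-inc slopes σ-inc j = σ 2j (suc 2j) , λ i i≢j → above i i≢j
    where
    2j = double ‼ j
    μ  = σ 2j (suc 2j)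
    above : ∀ i → ¬ i ≡ j → s 2j - μ * t 2j < s (double ‼ i) - μ * t (double ‼ i)
    above i i≢j with ℕ.<-cmp i j
    ... | tri≈ _ i≡j _ = contradiction i≡j i≢j
    ... | tri> _ _ j<i = difference-<
      (*-pos (<⇒0<- (σ-inc 2j (ℕ.n<1+n 2j) 2j+1<2i)) (<⇒0<- (t-inc (proj₂ double j<i))))
      (≈-trans
        (solve 5 (λ sⱼ σ μ tᵢ tⱼ → (σ :- μ) :* (tᵢ :- tⱼ) :=
                    ((sⱼ :+ σ :* (tᵢ :- tⱼ)) :- μ :* tᵢ) :- (sⱼ :- μ :* tⱼ)) ≈-refl
          (s 2j) (σ 2j 2i) μ (t 2i) (t 2j))
        (+-congʳ (+-congʳ (≈-sym (slopes (proj₂ double j<i))))))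
      where
      2i = double ‼ i
      2j+1<2i : suc 2j ℕ.< 2i
      2j+1<2i = ≡.subst (ℕ._≤ 2i) (≡.cong suc (ℕ.+-suc j j)) (ℕ.+-mono-≤ j<i j<i)
    ... | tri< i<j _ _ = difference-<
      (*-pos σ<μ (<⇒0<- (t-inc 2i<2j)))
      (≈-trans
        (solve 5 (λ sᵢ σ μ tᵢ tⱼ → (μ :- σ) :* (tⱼ :- tᵢ) :=
                    (sᵢ :- μ :* tᵢ) :- ((sᵢ :+ σ :* (tⱼ :- tᵢ)) :- μ :* tⱼ)) ≈-refl
          (s 2i) (σ 2i 2j) μ (t 2i) (t 2j))
        (+-congˡ (-‿cong (+-congʳ (≈-sym (slopes 2i<2j))))))
      where
      2i = double ‼ i
      k  = suc 2j
      2i<2j = proj₂ double i<j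
      2j<k = ℕ.n<1+n 2j
      -- The chord from 2i to k and the path through 2j end at the same point. Since `σ 2i k`
      -- exceeds `σ 2i 2j`, the second piece of the path must be steeper than the first.
      chords : s 2i + σ 2i k * (t k - t 2i) ≈ (s 2i + σ 2i 2j * (t 2j - t 2i)) + μ * (t k - t 2j)
      chords = ≈-trans (≈-sym (slopes (ℕ.<-trans 2i<2j 2j<k)))
        (≈-trans (slopes 2j<k) (+-congʳ (slopes 2i<2j)))
      σ<μ : 0# < μ - σ 2i 2j
      σ<μ = *-cancelʳ-pos {y = t k - t 2j} (<⇒0<- (t-inc 2j<k))
        (<-≤-trans
          (*-pos (<⇒0<- (σ-inc 2i 2i<2j 2j<k)) (<⇒0<- (t-inc (ℕ.<-trans 2i<2j 2j<k))))
          (≤-reflexive (≈-trans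
            (solve 6 (λ sᵢ σ σ′ tᵢ tⱼ tₖ → (σ′ :- σ) :* (tₖ :- tᵢ) :=
                (sᵢ :+ σ′ :* (tₖ :- tᵢ)) :- (sᵢ :+ σ :* (tₖ :- tᵢ))) ≈-refl
              (s 2i) (σ 2i 2j) (σ 2i k) (t 2i) (t 2j) (t k))
            (≈-trans (+-congʳ chords)
              (solve 6 (λ sᵢ σ μ tᵢ tⱼ tₖ →
                  ((sᵢ :+ σ :* (tⱼ :- tᵢ)) :+ μ :* (tₖ :- tⱼ)) :- (sᵢ :+ σ :* (tₖ :- tᵢ)) :=
                  (μ :- σ) :* (tₖ :- tⱼ)) ≈-refl
                (s 2i) (σ 2i 2j) μ (t 2i) (t 2j) (t k))))))

  slope : ∀ {t : ℕ → Carrier} (s : ℕ → Carrier) → StrictlyIncreasing t → ∃ (Slopes t s)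
  slope {t} s t-inc = (λ i j → proj₁ (chord i j)) , λ {i} {j} → proj₂ (chord i j)
    where
    chord : ∀ i j → ∃ λ σ → i ℕ.< j → s j ≈ s i + σ * (t j - t i)
    chord i j with i ℕ.<? j
    -- A default value: slopes matter only for i < j.
    ... | no i≮j  = 0# , λ i<j → contradiction i<j i≮j
    ... | yes i<j =
      let u , tu≈1 = invertible (t j - t i) (<⇒≉ (<⇒0<- (t-inc i<j)) ∘ ≈-sym)
      in (s j - s i) * u , λ _ → ≈-trans
           (≈-trans (solve 2 (λ sᵢ sⱼ → sⱼ := sᵢ :+ (sⱼ :- sᵢ)) ≈-refl (s i) (s j))
             (+-congˡ (≈-trans (≈-sym (*-identityʳ _)) (*-congˡ (≈-sym tu≈1)))))
           (solve 4 (λ sᵢ Δ τ u → sᵢ :+ Δ :* (τ :* u) := sᵢ :+ (Δ :* u) :* τ) ≈-refl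
             (s i) (s j - s i) (t j - t i) u)

  monotone-after : ∀ (_∼_ : Rel Carrier ℓr) (y : ℕ → Carrier) {i j k} →
    Monotone _∼_ (λ m → y (suc i ℕ.+ m)) → i ℕ.< j → j ℕ.< k → y j ∼ y k
  monotone-after _∼_ y {i} mono i<j j<k = ≡.subst₂ (λ j k → y j ∼ y k)
    (ℕ.m+[n∸m]≡n i<j) (ℕ.m+[n∸m]≡n (ℕ.<-trans i<j j<k)) (mono (ℕ.∸-monoˡ-< j<k i<j))

  Homogeneous : Rel Carrier ℓr → (ℕ → ℕ → Carrier) → Subsequence → Set ℓr
  Homogeneous _∼_ σ g = ∀ i {j k} → i ℕ.< j → j ℕ.< k → σ (g ‼ i) (g ‼ j) ∼ σ (g ‼ i) (g ‼ k)

  -- Diagonalisation gives every row of σ a trend beyond its own index, and the pigeonhole principle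
  -- selects rows with the same trend.
  homogeneous-subsequence : ∀ (σ : ℕ → ℕ → Carrier) → ∃ λ g →
    Homogeneous _<_ σ g ⊎ Homogeneous (λ x y → y < x) σ g ⊎ Homogeneous _≈_ σ g
  homogeneous-subsequence σ = choose (diagonal (λ a x → Trend (λ m → σ a (x m)))
    (λ {a} h t≡s → trend-thin h (λ m → ≡.cong (σ a) (t≡s m)))
    (λ a x → trend-subsequence (λ m → σ a (x ‼ m))))
    where
    Tail : Rel Carrier ℓr → Subsequence → ℕ → Set ℓr
    Tail _∼_ g n = Monotone _∼_ (λ m → σ (g ‼ n) (g ‼ (suc n ℕ.+ m)))
    assemble : ∀ _∼_ g h → (∀ n → Tail _∼_ g (h ‼ n)) → Homogeneous _∼_ σ (g ⊚ h)
    assemble _∼_ g h tail i i<j j<k =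
      monotone-after _∼_ (λ j → σ (g ‼ (h ‼ i)) (g ‼ j)) (tail i) (proj₂ h i<j) (proj₂ h j<k)
    choose : (∃ λ g → ∀ n → Trend (λ m → σ (g ‼ n) (g ‼ (suc n ℕ.+ m)))) → ∃ λ g →
      Homogeneous _<_ σ g ⊎ Homogeneous (λ x y → y < x) σ g ⊎ Homogeneous _≈_ σ g
    choose (g , good) =
      let h , all = pigeonhole₃ {P = Tail _<_ g} {Tail (λ x y → y < x) g} {Tail _≈_ g} good
      in g ⊚ h , Sum.map (assemble _<_ g h) (Sum.map (assemble (λ x y → y < x) g h) (assemble _≈_ g h)) all

  cup-cap-or-line : ∀ (t s : ℕ → Carrier) → StrictlyIncreasing t → ∃ λ (g : Subsequence) →
    let t′ = λ n → t (g ‼ n) ; s′ = λ n → s (g ‼ n) in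
    Supported t′ s′ ⊎ Supported t′ (λ n → - s′ n) ⊎ ∃₂ λ a b → ∀ n → s′ n ≈ a * t′ n + b
  cup-cap-or-line t s t-inc = let σ , slopes = slope s t-inc in classify σ slopes (homogeneous-subsequence σ)
    where
    classify : ∀ σ → Slopes t s σ → (∃ λ g →
        Homogeneous _<_ σ g ⊎ Homogeneous (λ x y → y < x) σ g ⊎ Homogeneous _≈_ σ g) →
      ∃ λ (g : Subsequence) → let t′ = λ n → t (g ‼ n) ; s′ = λ n → s (g ‼ n) in
      Supported t′ s′ ⊎ Supported t′ (λ n → - s′ n) ⊎ ∃₂ λ a b → ∀ n → s′ n ≈ a * t′ n + b
    classify σ slopes (g , inj₁ inc) = g ⊚ double , inj₁
      (increasing-slopes⇒supported {λ n → t (g ‼ n)} {λ n → s (g ‼ n)} {λ i j → σ (g ‼ i) (g ‼ j)}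
        (λ i<j → t-inc (proj₂ g i<j)) (λ i<j → slopes (proj₂ g i<j)) inc)
    classify σ slopes (g , inj₂ (inj₁ dec)) = g ⊚ double , inj₂ (inj₁
      (increasing-slopes⇒supported {λ n → t (g ‼ n)} {λ n → - s (g ‼ n)} {λ i j → - σ (g ‼ i) (g ‼ j)}
        (λ i<j → t-inc (proj₂ g i<j))
        (λ {i} {j} i<j → ≈-trans (-‿cong (slopes (proj₂ g i<j)))
          (solve 3 (λ sᵢ σ τ → :- (sᵢ :+ σ :* τ) := (:- sᵢ) :+ (:- σ) :* τ) ≈-refl
            (s (g ‼ i)) (σ (g ‼ i) (g ‼ j)) (t (g ‼ j) - t (g ‼ i))))
        (λ i i<j j<k → neg-mono-< (dec i i<j j<k))))
    -- The base point of the chords is dropped, because its slopes lead to later points only.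
    classify σ slopes (g , inj₂ (inj₂ const)) = g ⊚ shift 1 , inj₂ (inj₂ (σ₀ , s i - σ₀ * t i , λ n →
      ≈-trans (slopes (proj₂ g (ℕ.s≤s ℕ.z≤n))) (≈-trans (+-congˡ (*-congʳ (σ≈σ₀ n)))
        (solve 4 (λ sᵢ σ tᵢ tₙ → sᵢ :+ σ :* (tₙ :- tᵢ) := σ :* tₙ :+ (sᵢ :- σ :* tᵢ)) ≈-refl
          (s i) σ₀ (t i) (t (g ‼ suc n))))))
      where
      i = g ‼ 0
      σ₀ = σ i (g ‼ 1)
      σ≈σ₀ : ∀ n → σ i (g ‼ suc n) ≈ σ₀
      σ≈σ₀ zero    = ≈-refl
      σ≈σ₀ (suc n) = ≈-sym (const 0 (ℕ.s≤s ℕ.z≤n) (ℕ.s≤s (ℕ.s≤s ℕ.z≤n)))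

-- Order embeddings of the rationals

ℚ-<⇒≱ : ∀ {x y} → x ℚ.< y → ¬ y ℚ.≤ x
ℚ-<⇒≱ x<y y≤x = ℚ.<-irrefl refl (ℚ.<-≤-trans x<y y≤x)

-- As ℚ is total, cancellation is the contrapositive of strictness, and injectivity follows by
-- antisymmetry.
strict⇒orderMonomorphism : {A : Set a} {_≈_ : Rel A ℓ₁} {_≤_ : Rel A ℓ₂} → IsEquivalence _≈_ → _≈_ ⇒ _≤_ →
  (f : ℚ → A) → (∀ {x y} → x ℚ.< y → f x ≤ f y × ¬ f y ≤ f x) →
  IsOrderMonomorphism _≡_ _≈_ ℚ._≤_ _≤_ f
strict⇒orderMonomorphism {_≈_ = _≈_} {_≤_} isEquivalence ≈⇒≤ f strict = record
  { isOrderHomomorphism = record { cong = λ { refl → ≈.refl } ; mono = mono }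
  ; injective = injective
  ; cancel    = cancel
  }
  where
  module ≈ = IsEquivalence isEquivalence
  mono : ∀ {x y} → x ℚ.≤ y → f x ≤ f y
  mono {x} {y} x≤y with ℚ.<-cmp x y
  ... | tri< x<y _ _  = proj₁ (strict x<y)
  ... | tri≈ _ refl _ = ≈⇒≤ ≈.refl
  ... | tri> _ _ y<x  = contradiction x≤y (ℚ-<⇒≱ y<x)
  cancel : ∀ {x y} → f x ≤ f y → x ℚ.≤ y
  cancel fx≤fy = ℚ.≮⇒≥ λ y<x → proj₂ (strict y<x) fx≤fy
  injective : ∀ {x y} → f x ≈ f y → x ≡ y
  injective fx≈fy = ℚ.≤-antisym (cancel (≈⇒≤ fx≈fy)) (cancel (≈⇒≤ (≈.sym fx≈fy)))

-- Convex predicates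

module Convexity (em : ∀ {ℓ} → ExcludedMiddle ℓ) {r ℓr m ℓm} (ℝ : Reals r ℓr)
                 (V : Module (Reals.commutativeRing ℝ) m ℓm) where

  open Classical em
  open VectorSpace ℝ V
  open Module V using (≈ᴹ-refl; ≈ᴹ-sym; ≈ᴹ-trans; +ᴹ-cong; *ₗ-cong)
  open OrderedField em ℝ
  open LinearSolver V using (proveᴹ; vec; _:⊕_; _:•_; var; _:+_; _:*_; _:-_; :-_; :1; :0; ⟦0⟧≈0; ⟦1⟧≈1; solve; _:=_)

  -- Predicates of every level are allowed, so convex sets can be described by existential formulas;
  -- excluded middle turns them into subsets afterwards.
  record IsConvex (P : Pred Carrierᴹ p) : Set (r ⊔ ℓr ⊔ m ⊔ ℓm ⊔ p) where
    field
      resp   : P Respects _≈ᴹ_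
      convex : ∀ {x y} → P x → P y → ∀ {s t} → 0# ≤ s → 0# ≤ t → s + t ≈ 1# → P (s *ₗ x +ᴹ t *ₗ y)

  open IsConvex

  invariant : {P : Pred Carrierᴹ p} → IsConvex P → Invariant ≈ᴹ-setoid P
  invariant cvx x y = resp cvx

  toSubset : {P : Pred Carrierᴹ p} → IsConvex P → Subset ≈ᴹ-setoid
  toSubset {P = P} cvx = comprehension ≈ᴹ-setoid P (invariant cvx)

  toSubset-convex : {P : Pred Carrierᴹ p} (cvx : IsConvex P) → Convex (toSubset cvx)
  toSubset-convex {P = P} cvx x y x∈ y∈ s t 0≤s 0≤t s+t≈1 = ∈-comprehension⁺ ≈ᴹ-setoid P (invariant cvx) _
    (convex cvx (∈-comprehension⁻ ≈ᴹ-setoid P (invariant cvx) _ x∈)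
                (∈-comprehension⁻ ≈ᴹ-setoid P (invariant cvx) _ y∈) 0≤s 0≤t s+t≈1)

  ∈-convex : (C : Subset ≈ᴹ-setoid) → Convex C → IsConvex (_∈ C)
  ∈-convex C cvx = record
    { resp   = ∈-resp C
    ; convex = λ x∈ y∈ 0≤s 0≤t → cvx _ _ x∈ y∈ _ _ 0≤s 0≤t
    }

  -- The formula of `_≼_` without the line, so that inequalities in a trace can be used here as they
  -- are.
  Ahead : Carrierᴹ → Rel Carrierᴹ (r ⊔ ℓr ⊔ ℓm)
  Ahead d x y = ∃ λ t → 0# ≤ t × y ≈ᴹ x +ᴹ t *ₗ d

  ahead-0 : ∀ {d x y} → x ≈ᴹ y → Ahead d x y
  ahead-0 {d} {x} x≈y = 0# - 0# , ≤-reflexive (≈-sym ⟦0⟧≈0) ,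
    ≈ᴹ-trans (≈ᴹ-sym x≈y) (proveᴹ [] (x ∷ d ∷ []) (vec 0F) (vec 0F :⊕ :0 :• vec 1F) (≈-refl , ≈-refl , tt))

  -- If y = x + s d and z = y + t d, then y is the combination of x and z with weights t / (s + t)
  -- and s / (s + t). When s + t vanishes, so does t, and y = z.
  between : ∀ {P : Pred Carrierᴹ p} → IsConvex P → ∀ {d x y z} →
    P x → P z → Ahead d x y → Ahead d y z → P y
  between {P = P} cvx {d} {x} {y} {z} px pz (s , 0≤s , y≈) (t , 0≤t , z≈) with em {P = s + t ≈ 0#}
  ... | yes s+t≈0 = resp cvx
    (≈ᴹ-trans z≈ (≈ᴹ-trans (+ᴹ-cong ≈ᴹ-refl (*ₗ-cong t≈0 ≈ᴹ-refl))
      (proveᴹ [] (y ∷ d ∷ []) (vec 0F :⊕ :0 :• vec 1F) (vec 0F) (≈-refl , ≈-refl , tt)))) pz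
    where
    t≈0 : t ≈ 0# - 0#
    t≈0 = ≈-trans (≤-antisym
      (difference-≤ 0≤s (≈-trans (solve 2 (λ s t → s := (s :+ t) :- t) ≈-refl s t) (+-congʳ s+t≈0)))
      0≤t) (≈-sym ⟦0⟧≈0)
  ... | no s+t≉0 = resp cvx (≈ᴹ-sym y-combination)
      (convex cvx px pz (*-nonNeg 0≤t 0≤u) (*-nonNeg 0≤s 0≤u)
        (≈-trans (solve 3 (λ s t u → t :* u :+ s :* u := (s :+ t) :* u) ≈-refl s t u) su≈1))
    where
    u = proj₁ (invertible (s + t) s+t≉0)
    su≈1 = proj₂ (invertible (s + t) s+t≉0)
    0≤u = inverse-nonNeg (+-nonNeg 0≤s 0≤t) su≈1
    -- The equation (s + t) u = 1 is beyond the solver; replacing the coefficient 1 by (s + t) u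
    -- leaves a polynomial identity.
    y-combination : y ≈ᴹ (t * u) *ₗ x +ᴹ (s * u) *ₗ z
    y-combination = ≈ᴹ-trans y≈ (≈ᴹ-trans
      (≈ᴹ-trans (proveᴹ (s ∷ []) (x ∷ d ∷ []) (vec 0F :⊕ var 0F :• vec 1F)
          (:1 :• vec 0F :⊕ (var 0F :* :1) :• vec 1F) (≈-refl , ≈-refl , tt))
        (+ᴹ-cong (*ₗ-cong 1≈ ≈ᴹ-refl) (*ₗ-cong (*-congˡ 1≈) ≈ᴹ-refl)))
      (≈ᴹ-trans
        (proveᴹ (s ∷ t ∷ u ∷ []) (x ∷ d ∷ [])
          (((var 0F :+ var 1F) :* var 2F) :• vec 0F :⊕ (var 0F :* ((var 0F :+ var 1F) :* var 2F)) :• vec 1F)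
          ((var 1F :* var 2F) :• vec 0F :⊕ (var 0F :* var 2F) :• (vec 0F :⊕ var 0F :• vec 1F :⊕ var 1F :• vec 1F))
          (≈-refl , ≈-refl , tt))
        (+ᴹ-cong ≈ᴹ-refl (*ₗ-cong ≈-refl
          (≈ᴹ-sym (≈ᴹ-trans z≈ (+ᴹ-cong y≈ ≈ᴹ-refl)))))))
      where
      1≈ = ≈-trans ⟦1⟧≈1 (≈-sym su≈1)

  -- The lattice of relatively convex sets

  module Lattice (X : Subset ≈ᴹ-setoid) where

    Point : Set m
    Point = Setoid.Carrier ⟦ X ⟧

    L : Poset _ _ _
    L = Co X

    open Poset L using () renaming (Carrier to ∣L∣; _≤_ to _≤ᴸ_)

    -- Defined from above, as an intersection, which avoids sums over finite families; the finitary
    -- content is recovered in `finiteClosure-compact`.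
    Hull : Pred Point p → Pred Carrierᴹ _
    Hull Z v = ∀ C → Convex C → (∀ x → Z x → proj₁ x ∈ C) → v ∈ C

    hull-convex : {Z : Pred Point p} → IsConvex (Hull Z)
    hull-convex = record
      { resp   = λ x≈y hx C cvx Z⊆C → ∈-resp C x≈y (hx C cvx Z⊆C)
      ; convex = λ hx hy 0≤s 0≤t s+t≈1 C cvx Z⊆C →
          cvx _ _ (hx C cvx Z⊆C) (hy C cvx Z⊆C) _ _ 0≤s 0≤t s+t≈1
      }

    hull-⊇ : {Z : Pred Point p} → ∀ x → Z x → Hull Z (proj₁ x)
    hull-⊇ x zx C cvx Z⊆C = Z⊆C x zx

    -- `Hull` quantifies over subsets only. The predicate P, whatever its level, enters through its
    -- characteristic function.
    hull-least : {Z : Pred Point p} {P : Pred Carrierᴹ q} → IsConvex P →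
      (∀ x → Z x → P (proj₁ x)) → ∀ {v} → Hull Z v → P v
    hull-least {P = P} cvx Z⊆P hv = ∈-comprehension⁻ ≈ᴹ-setoid P (invariant cvx) _
      (hv (toSubset cvx) (toSubset-convex cvx)
        λ x zx → ∈-comprehension⁺ ≈ᴹ-setoid P (invariant cvx) _ (Z⊆P x zx))

    relConvex-resp : ∀ {Y Z} → Setoid._≈_ (𝒫 ⟦ X ⟧) Y Z → RelConvex X Z → RelConvex X Y
    relConvex-resp Y≈Z (C , cvx , Z⇔C) = C , cvx , λ x → mk⇔
      (λ x∈Y → Equivalence.to (Z⇔C x) (≡.trans (≡.sym (Y≈Z x)) x∈Y))
      (λ x∈C → ≡.trans (Y≈Z x) (Equivalence.from (Z⇔C x) x∈C))

    relConvex-between : ∀ {Y} → RelConvex X Y → ∀ {d} {x y z : Point} → x ∈ Y → z ∈ Y →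
      Ahead d (proj₁ x) (proj₁ y) → Ahead d (proj₁ y) (proj₁ z) → y ∈ Y
    relConvex-between (C , cvx , Y⇔C) {x = x} {y} {z} x∈Y z∈Y xy yz = Equivalence.from (Y⇔C y)
      (between (∈-convex C cvx) (Equivalence.to (Y⇔C x) x∈Y) (Equivalence.to (Y⇔C z) z∈Y) xy yz)

    hull-closed : (K : ∣L∣) {x : Point} → Hull (_∈ proj₁ K) (proj₁ x) → x ∈ proj₁ K
    hull-closed (Y , C , cvx , Y⇔C) {x} hx =
      Equivalence.from (Y⇔C x) (hx C cvx λ y → Equivalence.to (Y⇔C y))

    private
      onPoints : {P : Pred Carrierᴹ p} → IsConvex P → Invariant ⟦ X ⟧ (P ∘ proj₁)
      onPoints cvx x y = resp cvx

    meet : {P : Pred Carrierᴹ p} → IsConvex P → ∣L∣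
    meet {P = P} cvx = comprehension ⟦ X ⟧ (P ∘ proj₁) (onPoints cvx) ,
      toSubset cvx , toSubset-convex cvx , λ x → mk⇔
        (∈-comprehension⁺ ≈ᴹ-setoid P (invariant cvx) _ ∘ ∈-comprehension⁻ ⟦ X ⟧ (P ∘ proj₁) (onPoints cvx) x)
        (∈-comprehension⁺ ⟦ X ⟧ (P ∘ proj₁) (onPoints cvx) x ∘ ∈-comprehension⁻ ≈ᴹ-setoid P (invariant cvx) _)

    module _ {P : Pred Carrierᴹ p} (cvx : IsConvex P) where

      ∈-meet⁺ : ∀ {x} → P (proj₁ x) → x ∈ proj₁ (meet cvx)
      ∈-meet⁺ {x} = ∈-comprehension⁺ ⟦ X ⟧ (P ∘ proj₁) (onPoints cvx) x

      ∈-meet⁻ : ∀ {x} → x ∈ proj₁ (meet cvx) → P (proj₁ x)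
      ∈-meet⁻ {x} = ∈-comprehension⁻ ⟦ X ⟧ (P ∘ proj₁) (onPoints cvx) x

    module DirectedUnion {I : Set q} (K : I → ∣L∣)
                         (directed : ∀ i j → ∃ λ k → K i ≤ᴸ K k × K j ≤ᴸ K k) where

      -- Hulls of the members are united, not the convex sets that witness them: these witnesses
      -- need not grow with the members.
      union-convex : IsConvex (λ v → ∃ λ i → Hull (_∈ proj₁ (K i)) v)
      union-convex = record
        { resp   = λ x≈y → map₂ (resp hull-convex x≈y)
        ; convex = λ (i , hx) (j , hy) 0≤s 0≤t s+t≈1 →
            let k , i≤k , j≤k = directed i j in k , convex hull-convex
              (λ C cvx K⊆C → hx C cvx λ z z∈ → K⊆C z (i≤k z z∈))
              (λ C cvx K⊆C → hy C cvx λ z z∈ → K⊆C z (j≤k z z∈)) 0≤s 0≤t s+t≈1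
        }

      ⋃ : ∣L∣
      ⋃ = meet union-convex

      ∈-⋃⁺ : ∀ {x} i → x ∈ proj₁ (K i) → x ∈ proj₁ ⋃
      ∈-⋃⁺ {x} i x∈ = ∈-meet⁺ union-convex {x} (i , hull-⊇ x x∈)

      ∈-⋃⁻ : ∀ {x} → x ∈ proj₁ ⋃ → ∃ λ i → x ∈ proj₁ (K i)
      ∈-⋃⁻ {x} x∈ = map₂ (λ {i} → hull-closed (K i) {x}) (∈-meet⁻ union-convex {x} x∈)

    closure : Pred Point p → ∣L∣
    closure Z = meet (hull-convex {Z = Z})

    ∈-closure⁺ : {Z : Pred Point p} → ∀ {x} → Hull Z (proj₁ x) → x ∈ proj₁ (closure Z)
    ∈-closure⁺ {Z = Z} {x} = ∈-meet⁺ (hull-convex {Z = Z}) {x}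

    ∈-closure⁻ : {Z : Pred Point p} → ∀ {x} → x ∈ proj₁ (closure Z) → Hull Z (proj₁ x)
    ∈-closure⁻ {Z = Z} {x} = ∈-meet⁻ (hull-convex {Z = Z}) {x}

    closure-least : {Z : Pred Point p} (K : ∣L∣) → (∀ x → Z x → x ∈ proj₁ K) → closure Z ≤ᴸ K
    closure-least {Z = Z} K Z⊆K x x∈ = hull-closed K {x}
      λ C cvx K⊆C → ∈-closure⁻ {Z = Z} {x} x∈ C cvx λ y zy → K⊆C y (Z⊆K y zy)

    closure-⊇ : {Z : Pred Point p} → ∀ x → Z x → x ∈ proj₁ (closure Z)
    closure-⊇ {Z = Z} x zx = ∈-closure⁺ {Z = Z} {x} (hull-⊇ x zx)

    -- From topological scatteredness to order-scatteredness

    -- The strict inequality makes every cut a limit of smaller cuts: finitely many coordinates of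
    -- the cut at x are already settled at some y < x, hence shared by each cut in between.
    topScattered⇒orderScattered : TopScattered ⟦ X ⟧ (RelConvex X) → OrderScatteredPoset L
    topScattered⇒orderScattered scattered (f , f-mono) =
      let y , y<x , close = approximate x F
          z , y<z , z<x   = ℚ.<-dense y<x
          w , z<w , w<x   = ℚ.<-dense z<x
          cut-z∈U         = proj₂ (U-open h h∈U) (proj₁ (cut z)) (All.map (λ {v} → agree y<z z<x {v}) close)
          cut-z≈h         = Equivalence.to (isolated (proj₁ (cut z))) (cut-z∈U , cut∈Y z)
      -- Isolation identifies the cut at z with the cut at x, which contains `f w`. Members of the
      -- former come from some `f u` with u < z, so `f w` would lie below `f z`.
      in ℚ-<⇒≱ z<w (cancel λ v v∈fw →
           let u , v∈fu = U.∈-⋃⁻ z {v} (≡.trans (cut-z≈h v)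
                 (≡.trans (h≈cut v) (U.∈-⋃⁺ x {v} (w , w<x) v∈fw)))
           in mono (ℚ.<⇒≤ (proj₂ u)) v v∈fu)
      where
      open IsOrderMonomorphism f-mono
      Below : ℚ → Set
      Below x = ∃ (ℚ._< x)
      directed : ∀ x (i j : Below x) → ∃ λ (k : Below x) → f (proj₁ i) ≤ᴸ f (proj₁ k) × f (proj₁ j) ≤ᴸ f (proj₁ k)
      directed x (i , i<x) (j , j<x) with ℚ.≤-total i j
      ... | inj₁ i≤j = (j , j<x) , mono i≤j , λ _ → id
      ... | inj₂ j≤i = (i , i<x) , (λ _ → id) , mono j≤i
      module U (x : ℚ) = DirectedUnion {I = Below x} (f ∘ proj₁) (directed x)
      cut : ℚ → ∣L∣
      cut = U.⋃
      IsCut : Pred (Subset ⟦ X ⟧) _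
      IsCut Z = ∃ λ x → Setoid._≈_ (𝒫 ⟦ X ⟧) Z (proj₁ (cut x))
      isCut-resp : Invariant (𝒫 ⟦ X ⟧) IsCut
      isCut-resp Z W Z≈W (x , Z≈) = x , λ v → ≡.trans (≡.sym (Z≈W v)) (Z≈ v)
      Y : Subset (𝒫 ⟦ X ⟧)
      Y = comprehension (𝒫 ⟦ X ⟧) IsCut isCut-resp
      cut∈Y : ∀ x → proj₁ (cut x) ∈ Y
      cut∈Y x = ∈-comprehension⁺ (𝒫 ⟦ X ⟧) IsCut isCut-resp (proj₁ (cut x)) (x , λ _ → refl)
      isolatedPoint = scattered Y
        (λ Z Z∈Y → let x , Z≈ = ∈-comprehension⁻ (𝒫 ⟦ X ⟧) IsCut isCut-resp Z Z∈Y
                   in relConvex-resp {Z} {proj₁ (cut x)} Z≈ (proj₂ (cut x)))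
        (proj₁ (cut 0ℚ) , cut∈Y 0ℚ)
      h = proj₁ isolatedPoint
      U = proj₁ (proj₂ isolatedPoint)
      U-open = proj₁ (proj₂ (proj₂ isolatedPoint))
      isolated = proj₂ (proj₂ (proj₂ isolatedPoint))
      h∈ = Equivalence.from (isolated h) λ _ → refl
      h∈U = proj₁ h∈
      h-cut = ∈-comprehension⁻ (𝒫 ⟦ X ⟧) IsCut isCut-resp h (proj₂ h∈)
      x = proj₁ h-cut
      h≈cut = proj₂ h-cut
      F = proj₁ (U-open h h∈U)
      approximate : ∀ x (F : List Point) → ∃ λ y → y ℚ.< x ×
        All (λ v → v ∈ proj₁ (cut x) → v ∈ proj₁ (f y)) F
      approximate x [] = x ℚ.- 1ℚ , ≡.subst (x ℚ.- 1ℚ ℚ.<_) (ℚ.+-identityʳ x)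
        (ℚ.+-monoʳ-< x (ℚ.*<* ℤ.-<+)) , []
      approximate x (v ∷ F) with em {P = v ∈ proj₁ (cut x)} | approximate x F
      ... | no v∉  | y , y<x , all = y , y<x , (λ v∈ → contradiction v∈ v∉) ∷ all
      ... | yes v∈ | y , y<x , all =
        let (u , u<x) , v∈fu      = U.∈-⋃⁻ x {v} v∈
            (k , k<x) , u≤k , y≤k = directed x (u , u<x) (y , y<x)
        in k , k<x , (λ _ → u≤k v v∈fu) ∷ All.map (λ {w} g w∈ → y≤k w (g w∈)) all
      agree : ∀ {y z} → y ℚ.< z → z ℚ.< x → ∀ {v} →
        (v ∈ proj₁ (cut x) → v ∈ proj₁ (f y)) → proj₁ (cut z) ⟨$⟩ v ≡ h ⟨$⟩ v
      agree {y} {z} y<z z<x {v} close = ≡.trans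
        (iff⇒≡ (λ v∈ → let (u , u<z) , v∈fu = U.∈-⋃⁻ z {v} v∈
                       in U.∈-⋃⁺ x {v} (u , ℚ.<-trans u<z z<x) v∈fu)
               (λ v∈ → U.∈-⋃⁺ z {v} (y , y<z) (close v∈)))
        (≡.sym (h≈cut v))

    -- Compact elements of an order-scattered lattice

    S : Poset _ _ _
    S = compactElements L

    orderScattered⇒compactsScattered : OrderScatteredPoset L → OrderScatteredPoset S
    orderScattered⇒compactsScattered scattered (f , f-mono) = scattered (proj₁ ∘ f , record
      { isOrderHomomorphism = record { cong = cong ; mono = mono }
      ; injective = injective
      ; cancel    = cancel
      })
      where open IsOrderMonomorphism f-mono

    -- The power set of ℕ contains ℚ, in the guise of the sets {n ∣ enumℚ n ≤ x}.
    orderScattered⇒no-𝒫<ω : OrderScatteredPoset L → ¬ HasJoinSubsemilattice S 𝒫<ω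
    orderScattered⇒no-𝒫<ω scattered (f , f-mono , f-join) = scattered
      (U.⋃ , strict⇒orderMonomorphism (Poset.isEquivalence L) (λ {Z} {W} → Poset.reflexive L {Z} {W})
        U.⋃ λ {x} {y} x<y →
        (λ v v∈ → let (F , F≤x) , v∈F = U.∈-⋃⁻ x {v} v∈
                  in U.∈-⋃⁺ y {v} (F , All.map (λ n≤x → ℚ.≤-trans n≤x (ℚ.<⇒≤ x<y)) F≤x) v∈F)
        , λ y≤x → ℚ-<⇒≱ x<y (cancel y≤x))
      where
      open IsRelMonomorphism f-mono
      open Poset S using () renaming (_≤_ to _≤ˢ_)
      -- When `f F` lies below `f G`, the join `f (F ++ G)` equals `f G`, and injectivity gives
      -- `F ++ G` the same members as `G`.
      f-cancel : ∀ {F G} → f F ≤ˢ f G → F ⊆ G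
      f-cancel {F} {G} fF≤fG = proj₁ (injective (Poset.antisym S {f (F ++ G)} {f G}
        (proj₂ (proj₂ (f-join F G)) (f G) fF≤fG (Poset.refl S {f G}))
        (proj₁ (proj₂ (f-join F G))))) ∘ xs⊆xs++ys F G
      Lower : ℚ → Set
      Lower x = ∃ (All (λ n → enumℚ n ℚ.≤ x))
      K : ∀ {x} → Lower x → ∣L∣
      K (F , _) = proj₁ (f F)
      _⊔ˡ_ : ∀ {x} → Lower x → Lower x → Lower x
      (F , F≤x) ⊔ˡ (G , G≤x) = F ++ G , All.++⁺ F≤x G≤x
      directed : ∀ {x} (i j : Lower x) → ∃ λ (k : Lower x) → K i ≤ᴸ K k × K j ≤ᴸ K k
      directed i@(F , _) j@(G , _) = i ⊔ˡ j , proj₁ (f-join F G) , proj₁ (proj₂ (f-join F G))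
      module U (x : ℚ) = DirectedUnion {I = Lower x} K directed
      IsK : ℚ → Pred ∣L∣ _
      IsK x Z = ∃ λ (i : Lower x) → Poset._≈_ L Z (K i)
      isK-resp : ∀ x → Invariant (Poset.Eq.setoid L) (IsK x)
      isK-resp x Z W Z≈W (i , Z≈) = i , λ v → ≡.trans (≡.sym (Z≈W v)) (Z≈ v)
      bound : ∀ {x} (Ks : List ∣L∣) → All (IsK x) Ks → ∃ λ (i : Lower x) → All (_≤ᴸ K i) Ks
      bound []       []                = ([] , []) , []
      bound (Z ∷ Ks) ((i , Z≈) ∷ isKs) =
        let j , all         = bound Ks isKs
            k , i≤k , j≤k = directed i j
        in k , (λ v v∈ → i≤k v (≡.trans (≡.sym (Z≈ v)) v∈)) ∷ All.map (λ Z≤ v v∈ → j≤k v (Z≤ v v∈)) all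
      cancel : ∀ {x y} → U.⋃ y ≤ᴸ U.⋃ x → y ℚ.≤ x
      -- Let n be a code of y. The compact element `f [ n ]` lies below the union at x, so below a
      -- join of finitely many members, and so below one `f G` where all indices in G code rationals
      -- at most x. Cancelling puts n in G.
      cancel {x} {y} ⋃y≤⋃x =
        let n , enum≡y = code y
            Ks , Ks∈D , t , (_ , t-least) , fn≤t = proj₂ (f [ n ])
              (comprehension (Poset.Eq.setoid L) (IsK x) (isK-resp x)) (U.⋃ x)
              ( (λ Z Z∈D v v∈Z → let i , Z≈ = ∈-comprehension⁻ (Poset.Eq.setoid L) (IsK x) (isK-resp x) Z Z∈D
                                 in U.∈-⋃⁺ x {v} i (≡.trans (≡.sym (Z≈ v)) v∈Z))
              , (λ W ub v v∈ → let i , v∈K = U.∈-⋃⁻ x {v} v∈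
                               in ub (K i) (∈-comprehension⁺ (Poset.Eq.setoid L) (IsK x) (isK-resp x) (K i) (i , λ _ → refl)) v v∈K))
              (λ v v∈ → ⋃y≤⋃x v (U.∈-⋃⁺ y {v} ([ n ] , ℚ.≤-reflexive enum≡y ∷ []) v∈))
            (G , G≤x) , Ks≤G = bound Ks (All.map (λ {Z} → ∈-comprehension⁻ (Poset.Eq.setoid L) (IsK x) (isK-resp x) Z) Ks∈D)
            t≤fG = t-least (proj₁ (f G)) λ Z Z∈Ks → All.lookupₛ (Poset.Eq.setoid L) {P = _≤ᴸ proj₁ (f G)}
              (λ Z≈W Z≤ v v∈ → Z≤ v (≡.trans (Z≈W v) v∈)) Ks≤G {Z} Z∈Ks
        in ≡.subst (ℚ._≤ x) enum≡y
             (All.lookup G≤x (f-cancel (λ v v∈ → t≤fG v (fn≤t v v∈)) (here refl)))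

    -- Isolated members, one ray and one line at a time

    Family : Set _
    Family = Pred (Subset ⟦ X ⟧) (r ⊔ ℓr ⊔ m ⊔ ℓm)

    Agree : List Point → Rel (Subset ⟦ X ⟧) m
    Agree F W W′ = All (λ x → W ⟨$⟩ x ≡ W′ ⟨$⟩ x) F

    -- An isolated member as far as the coordinates in T can tell. The finite list F need not lie in
    -- T; for T = X this is isolation in the product topology.
    Isolates : Family → Pred Point p → Set _
    Isolates 𝒴 T = ∃ λ W → 𝒴 W × ∃ λ F → ∀ W′ → 𝒴 W′ → Agree F W′ W →
      ∀ x → T x → W′ ⟨$⟩ x ≡ W ⟨$⟩ x

    Resolves : Family → Pred Point p → Set _
    Resolves 𝒬 T = ∀ (𝒴 : Family) → (∀ W → 𝒴 W → 𝒬 W) → ∃ 𝒴 → Isolates 𝒴 T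

    -- After isolating W on T, the second isolation takes place among the members that agree with W
    -- on F. This is possible because `Resolves` speaks of all nonempty subfamilies.
    resolves-∪ : {𝒬 : Family} {T : Pred Point p} {T′ : Pred Point q} →
      Resolves 𝒬 T → Resolves 𝒬 T′ → Resolves 𝒬 (T ∪ T′)
    resolves-∪ {T = T} res res′ 𝒴 𝒴⊆𝒬 inhabited =
      let W , W∈𝒴 , F , fixed = res 𝒴 𝒴⊆𝒬 inhabited
          W′ , (W′∈𝒴 , W′~W) , F′ , fixed′ = res′ (λ Z → 𝒴 Z × Agree F Z W)
            (λ Z → 𝒴⊆𝒬 Z ∘ proj₁) (W , W∈𝒴 , All.universal (λ _ → refl) F)
      in W′ , W′∈𝒴 , F ++ F′ , λ Z Z∈𝒴 Z~W′ x →
           let Z~W = All.zipWith (λ (e , e′) → ≡.trans e e′) (All.++⁻ˡ F Z~W′ , W′~W)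
           in [ (λ Tx → ≡.trans (fixed Z Z∈𝒴 Z~W x Tx) (≡.sym (fixed W′ W′∈𝒴 W′~W x Tx)))
              , fixed′ Z (Z∈𝒴 , Z~W) (All.++⁻ʳ F Z~W′) x ]′

    resolves-⊆ : {𝒬 : Family} {T : Pred Point p} {T′ : Pred Point q} →
      (∀ x → T′ x → T x) → Resolves 𝒬 T → Resolves 𝒬 T′
    resolves-⊆ T′⊆T res 𝒴 𝒴⊆𝒬 inhabited =
      let W , W∈𝒴 , F , fixed = res 𝒴 𝒴⊆𝒬 inhabited
      in W , W∈𝒴 , F , λ Z Z∈𝒴 Z~W x T′x → fixed Z Z∈𝒴 Z~W x (T′⊆T x T′x)

    Ray : ∀ {l} → Orientation l → Point → Pred Point _
    Ray {l} o c x = proj₁ x on-line l × Ahead (Orientation.vector o) (proj₁ c) (proj₁ x)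

    ahead-total : ∀ {d c x y} → Ahead d c x → Ahead d c y → Ahead d x y ⊎ Ahead d y x
    ahead-total {d} {c} {x} {y} (s , _ , x≈) (t , _ , y≈) with ≤-total s t
    ... | inj₁ s≤t = inj₁ (t - s , ≤⇒0≤- s≤t , ≈ᴹ-trans y≈ (≈ᴹ-trans
      (proveᴹ (s ∷ t ∷ []) (c ∷ d ∷ []) (vec 0F :⊕ var 1F :• vec 1F)
        (vec 0F :⊕ var 0F :• vec 1F :⊕ (var 1F :- var 0F) :• vec 1F) (≈-refl , ≈-refl , tt))
      (+ᴹ-cong (≈ᴹ-sym x≈) ≈ᴹ-refl)))
    ... | inj₂ t≤s = inj₂ (s - t , ≤⇒0≤- t≤s , ≈ᴹ-trans x≈ (≈ᴹ-trans
      (proveᴹ (t ∷ s ∷ []) (c ∷ d ∷ []) (vec 0F :⊕ var 1F :• vec 1F)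
        (vec 0F :⊕ var 0F :• vec 1F :⊕ (var 1F :- var 0F) :• vec 1F) (≈-refl , ≈-refl , tt))
      (+ᴹ-cong (≈ᴹ-sym y≈) ≈ᴹ-refl)))

    ConvexThrough : Point → Family
    ConvexThrough c W = RelConvex X W × c ∈ W

    module _ {l} (o : Orientation l) (scattered : TraceOrderScattered X o) (c : Point) where

      -- Members through c meet the ray in initial segments, so a member containing x but not y
      -- shows that x strictly precedes y. A copy of ℚ for `_≺_` is therefore one for the order of
      -- the trace.
      ray-resolves : Resolves (ConvexThrough c) (Ray o c)
      ray-resolves 𝒴 𝒴⊆ (W₀ , W₀∈𝒴) = byContradiction λ ¬isolates →
        let
          another : ∀ W → 𝒴 W → ∀ F → ∃ λ W′ → 𝒴 W′ × Agree F W′ W ×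
            ∃ λ x → Ray o c x × ¬ W′ ⟨$⟩ x ≡ W ⟨$⟩ x
          another W W∈𝒴 F = byContradiction λ none → ¬isolates
            (W , W∈𝒴 , F , λ W′ W′∈𝒴 W′~W x Rx → byContradiction λ W′≢W →
              none (W′ , W′∈𝒴 , W′~W , x , Rx , W′≢W))
          f , f-mono = Cantor.cantor _≺_ (λ {x y z} → ≺-trans {x} {y} {z}) (λ {x y} → dense another {x} {y}) (separated another)
        in scattered
          ( trace ∘ f
          , strict⇒orderMonomorphism
              (record { refl = ≈ᴹ-refl ; sym = ≈ᴹ-sym ; trans = ≈ᴹ-trans }) ahead-0 (trace ∘ f)
              λ {x} {y} x<y → ≺⇒ahead {f x} {f y} (f-mono x<y) , ≺⇒¬behind {f x} {f y} (f-mono x<y))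
        where
        d = Orientation.vector o
        Chain = ∃ (Ray o c)
        point : Chain → Point
        point = proj₁
        trace : Chain → Trace X l
        trace ((x , x∈X) , on , _) = x , x∈X , on
        initial : ∀ {W} → 𝒴 W → ∀ {x y : Chain} → Ahead d (proj₁ (point x)) (proj₁ (point y)) →
          point y ∈ W → point x ∈ W
        initial {W} W∈𝒴 {x , _ , c≤x} {y , _} x≤y y∈W =
          relConvex-between {W} (proj₁ (𝒴⊆ W W∈𝒴)) {x = c} {x} {y} (proj₂ (𝒴⊆ W W∈𝒴)) y∈W c≤x x≤y
        _≺_ : Rel Chain _
        x ≺ y = ∃ λ W → 𝒴 W × point x ∈ W × ¬ point y ∈ W
        ≺⇒ahead : ∀ {x y} → x ≺ y → Ahead d (proj₁ (point x)) (proj₁ (point y))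
        ≺⇒ahead {x@(_ , _ , c≤x)} {y@(_ , _ , c≤y)} (W , W∈𝒴 , x∈W , y∉W) with ahead-total c≤x c≤y
        ... | inj₁ x≤y = x≤y
        ... | inj₂ y≤x = contradiction (initial W∈𝒴 {y} {x} y≤x x∈W) y∉W
        ≺⇒¬behind : ∀ {x y} → x ≺ y → ¬ Ahead d (proj₁ (point y)) (proj₁ (point x))
        ≺⇒¬behind {x} {y} (W , W∈𝒴 , x∈W , y∉W) y≤x = y∉W (initial W∈𝒴 {y} {x} y≤x x∈W)
        ≺-trans : ∀ {x y z} → x ≺ y → y ≺ z → x ≺ z
        ≺-trans {x} {y} {z} x≺y (W , W∈𝒴 , y∈W , z∉W) =
          W , W∈𝒴 , initial W∈𝒴 {x} {y} (≺⇒ahead {x} {y} x≺y) y∈W , z∉W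
        differ : ∀ {u v : Bool} → ¬ u ≡ v → (u ≡ true × ¬ v ≡ true) ⊎ (¬ u ≡ true × v ≡ true)
        differ {true}  {true}  u≢v = contradiction refl u≢v
        differ {true}  {false} _   = inj₁ (refl , λ ())
        differ {false} {true}  _   = inj₂ ((λ ()) , refl)
        differ {false} {false} u≢v = contradiction refl u≢v
        module _ (another : ∀ W → 𝒴 W → ∀ F → ∃ λ W′ → 𝒴 W′ × Agree F W′ W ×
                    ∃ λ x → Ray o c x × ¬ W′ ⟨$⟩ x ≡ W ⟨$⟩ x) where
          dense : ∀ {x y} → x ≺ y → ∃ λ z → x ≺ z × z ≺ y
          -- W′ agrees with W at x and y but differs at some z. Whichever of the two contains z
          -- separates z from y, and the other one separates x from z.
          dense {x} {y} (W , W∈𝒴 , x∈W , y∉W) with another W W∈𝒴 (point x ∷ point y ∷ [])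
          ... | W′ , W′∈𝒴 , ex ∷ ey ∷ [] , z , Rz , W′≢W with differ W′≢W
          ...   | inj₁ (z∈W′ , z∉W) = (z , Rz) , (W , W∈𝒴 , x∈W , z∉W)
                                    , (W′ , W′∈𝒴 , z∈W′ , y∉W ∘ ≡.trans (≡.sym ey))
          ...   | inj₂ (z∉W′ , z∈W) = (z , Rz) , (W′ , W′∈𝒴 , ≡.trans ex x∈W , z∉W′)
                                    , (W , W∈𝒴 , z∈W , y∉W)
          separates : ∀ W → 𝒴 W → (z : Chain) → point z ∈ W → ∃₂ _≺_
          separates W W∈𝒴 z z∈W with another W W∈𝒴 (point z ∷ [])
          ... | W′ , W′∈𝒴 , ez ∷ [] , y , Ry , W′≢W with differ W′≢W
          ...   | inj₁ (y∈W′ , y∉W) = z , (y , Ry) , W , W∈𝒴 , z∈W , y∉W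
          ...   | inj₂ (y∉W′ , y∈W) = z , (y , Ry) , W′ , W′∈𝒴 , ≡.trans ez z∈W , y∉W′
          separated : ∃₂ _≺_
          -- A first difference, with no coordinate fixed, supplies a member that contains a point
          -- of the ray; a second difference, with this point fixed, supplies a related pair.
          separated with another W₀ W₀∈𝒴 []
          ... | W′ , W′∈𝒴 , _ , z , Rz , W′≢W₀ with differ W′≢W₀
          ...   | inj₁ (z∈W′ , _) = separates W′ W′∈𝒴 (z , Rz) z∈W′
          ...   | inj₂ (_ , z∈W₀) = separates W₀ W₀∈𝒴 (z , Rz) z∈W₀

    IsRelConvex : Family
    IsRelConvex = RelConvex X

    forwards backwards : ∀ l → Orientation l
    forwards l = record
      { vector = direction ; nonzero = nonzero
      ; parallel = 1# , ≈ᴹ-sym (Module.*ₗ-identityˡ V direction) }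
      where open Line l
    backwards l = record
      { vector   = (- 1#) *ₗ direction
      ; nonzero  = λ e → nonzero (≈ᴹ-trans double-neg
          (≈ᴹ-trans (*ₗ-cong ≈-refl e) (Module.*ₗ-zeroʳ V (- 1#))))
      ; parallel = - 1# , ≈ᴹ-refl }
      where
      open Line l
      double-neg : direction ≈ᴹ (- 1#) *ₗ (- 1#) *ₗ direction
      double-neg = ≈ᴹ-trans
        (proveᴹ [] (direction ∷ []) (vec 0F) ((:- :1) :• (:- :1) :• vec 0F) (≈-refl , tt))
        (*ₗ-cong (-‿cong ⟦1⟧≈1) (*ₗ-cong (-‿cong ⟦1⟧≈1) ≈ᴹ-refl))

    ray-cover : ∀ l (c : Point) → proj₁ c on-line l → ∀ x → proj₁ x on-line l →
      Ray (forwards l) c x ⊎ Ray (backwards l) c x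
    ray-cover l (c , _) (s , c≈) (x , _) (t , x≈) with ≤-total s t
    ... | inj₁ s≤t = inj₁ ((t , x≈) , t - s , ≤⇒0≤- s≤t , ≈ᴹ-trans x≈ (≈ᴹ-trans
      (proveᴹ (s ∷ t ∷ []) (point ∷ direction ∷ []) (vec 0F :⊕ var 1F :• vec 1F)
        (vec 0F :⊕ var 0F :• vec 1F :⊕ (var 1F :- var 0F) :• vec 1F) (≈-refl , ≈-refl , tt))
      (+ᴹ-cong (≈ᴹ-sym c≈) ≈ᴹ-refl)))
      where open Line l
    ... | inj₂ t≤s = inj₂ ((t , x≈) , s - t , ≤⇒0≤- t≤s , ≈ᴹ-trans x≈ (≈ᴹ-trans
      (proveᴹ (s ∷ t ∷ 1# ∷ []) (point ∷ direction ∷ []) (vec 0F :⊕ var 1F :• vec 1F)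
        (vec 0F :⊕ var 0F :• vec 1F :⊕ (var 0F :- var 1F) :• (:- :1) :• vec 1F) (≈-refl , ≈-refl , tt))
      (+ᴹ-cong (≈ᴹ-sym c≈) (*ₗ-cong ≈-refl (*ₗ-cong (-‿cong ⟦1⟧≈1) ≈ᴹ-refl)))))
      where open Line l

    line-resolves : ∀ l → (∀ (o : Orientation l) → TraceOrderScattered X o) →
      Resolves IsRelConvex (λ x → proj₁ x on-line l)
    line-resolves l scattered 𝒴 𝒴⊆ (W₀ , W₀∈𝒴)
      with em {P = ∃ λ W → 𝒴 W × ∃ λ (c : Point) → c ∈ W × proj₁ c on-line l}
    -- All members are empty on this line.
    ... | no none = W₀ , W₀∈𝒴 , [] , λ W W∈𝒴 _ x on → iff⇒≡
      (λ x∈W → contradiction (W , W∈𝒴 , x , x∈W , on) none)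
      (λ x∈W₀ → contradiction (W₀ , W₀∈𝒴 , x , x∈W₀ , on) none)
    ... | yes (W , W∈𝒴 , c , c∈W , c-on) =
      let Z , (Z∈𝒴 , c∈Z) , F , fixed = resolves-⊆ (ray-cover l c c-on)
            (resolves-∪ (ray-resolves (forwards l) (scattered (forwards l)) c)
                        (ray-resolves (backwards l) (scattered (backwards l)) c))
            (λ Z → 𝒴 Z × c ∈ Z) (λ Z (Z∈𝒴 , c∈Z) → 𝒴⊆ Z Z∈𝒴 , c∈Z) (W , W∈𝒴 , c∈W)
      -- Fixing the coordinate c as well excludes the members that miss c, so isolation among the
      -- members through c is isolation in the whole family.
      in Z , Z∈𝒴 , c ∷ F , λ { Z′ Z′∈𝒴 (ec ∷ Z′~Z) → fixed Z′ (Z′∈𝒴 , ≡.trans ec c∈Z) Z′~Z }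

    lines-resolve : ∀ ls → All (λ l → ∀ (o : Orientation l) → TraceOrderScattered X o) ls →
      Resolves IsRelConvex (λ x → Any (proj₁ x on-line_) ls)
    lines-resolve []       []                      𝒴 𝒴⊆ (W₀ , W₀∈𝒴) = W₀ , W₀∈𝒴 , [] , λ _ _ _ _ ()
    lines-resolve (l ∷ ls) (scattered ∷ scattereds) = resolves-⊆ (λ x → Any.toSum)
      (resolves-∪ (line-resolves l scattered) (lines-resolve ls scattereds))

    scatteredLines⇒topScattered : CoveredByScatteredLines X → TopScattered ⟦ X ⟧ (RelConvex X)
    scatteredLines⇒topScattered (ls , cover , scattered) Y Y⊆L (W₀ , W₀∈Y) =
      let W , (W∈Y , W-convex) , F , fixed = lines-resolve ls scattered (λ W → W ∈ Y × RelConvex X W)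
            (λ _ → proj₂) (W₀ , W₀∈Y , Y⊆L W₀ W₀∈Y)
          invariant′ : Invariant (𝒫 ⟦ X ⟧) (λ Z → Agree F Z W)
          invariant′ = λ Z Z′ Z≈Z′ → All.map λ {x} e → ≡.trans (≡.sym (Z≈Z′ x)) e
          in-U  = ∈-comprehension⁺ (𝒫 ⟦ X ⟧) (λ Z → Agree F Z W) invariant′
          out-U = ∈-comprehension⁻ (𝒫 ⟦ X ⟧) (λ Z → Agree F Z W) invariant′
      in W , comprehension (𝒫 ⟦ X ⟧) (λ Z → Agree F Z W) invariant′
       , (λ Z Z∈U → F , λ Z′ Z′~Z → in-U Z′
            (All.zipWith (λ (e , e′) → ≡.trans e e′) (Z′~Z , out-U Z Z∈U)))
       , λ Z → mk⇔
          (λ (Z∈U , Z∈Y) (x , x∈X) → fixed Z (Z∈Y , Y⊆L Z Z∈Y) (out-U Z Z∈U) (x , x∈X) (cover x x∈X))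
          (λ Z≈W → in-U Z (All.universal Z≈W F) , ∈-resp Y {W} {Z} (λ x → ≡.sym (Z≈W x)) W∈Y)

    -- Closures of finite sets, and segments on a line

    finiteClosure : List Point → ∣L∣
    finiteClosure zs = closure (_∈ₗ zs)

    -- The hulls of finite subfamilies of D have a convex union, whose trace on X is an upper bound
    -- of D and so contains s. Each of the finitely many generators thus needs only finitely many
    -- members of D.
    finiteClosure-compact : ∀ zs → Compact L (finiteClosure zs)
    finiteClosure-compact zs D s (s-upper , s-least) zs≤s =
      let Ks , Ks∈D , zs⊆ = collect zs λ z z∈zs → inFinite (zs≤s z (closure-⊇ z z∈zs))
      in Ks , Ks∈D , closure (Member Ks)
       , ( (λ K K∈Ks x x∈K → closure-⊇ x (Any.map (λ K≈ → ≡.trans (≡.sym (K≈ x)) x∈K) K∈Ks))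
         , λ K ub → closure-least K λ x x∈Ks → below K ub x x∈Ks )
       , closure-least (closure (Member Ks)) λ z z∈zs → ∈-closure⁺ {Z = Member Ks} {z} (All.lookup zs⊆ z∈zs)
      where
      Member : List ∣L∣ → Pred Point _
      Member Ks x = Any (λ K → x ∈ proj₁ K) Ks
      below : ∀ {Ks} K → (∀ K′ → Any (Poset._≈_ L K′) Ks → K′ ≤ᴸ K) → ∀ x → Member Ks x → x ∈ proj₁ K
      below {K′ ∷ _} K ub x (here x∈K′) = ub K′ (here λ _ → refl) x x∈K′
      below K ub x (there x∈Ks) = below K (λ K′ K′∈ → ub K′ (there K′∈)) x x∈Ks
      FinitelyGenerated : Pred Carrierᴹ _
      FinitelyGenerated v = ∃ λ Ks → All (_∈ D) Ks × Hull (Member Ks) v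
      enlarge : ∀ {Ks Ks′ v} → (∀ x → Member Ks x → Member Ks′ x) → Hull (Member Ks) v → Hull (Member Ks′) v
      enlarge Ks⊆Ks′ hv C cvx ⊆C = hv C cvx λ x → ⊆C x ∘ Ks⊆Ks′ x
      generated-convex : IsConvex FinitelyGenerated
      generated-convex = record
        { resp   = λ x≈y (Ks , Ks∈D , hx) → Ks , Ks∈D , resp hull-convex x≈y hx
        ; convex = λ (Ks , Ks∈D , hx) (Ks′ , Ks′∈D , hy) 0≤s 0≤t s+t≈1 →
            Ks ++ Ks′ , All.++⁺ Ks∈D Ks′∈D , convex hull-convex
              (enlarge {Ks} {Ks ++ Ks′} (λ _ → Any.++⁺ˡ) hx)
              (enlarge {Ks′} {Ks ++ Ks′} (λ _ → Any.++⁺ʳ Ks) hy) 0≤s 0≤t s+t≈1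
        }
      inFinite : ∀ {x : Point} → x ∈ proj₁ s → FinitelyGenerated (proj₁ x)
      inFinite {x} x∈s = ∈-meet⁻ generated-convex {x} (s-least (meet generated-convex)
        (λ K K∈D y y∈K → ∈-meet⁺ generated-convex {y} (K ∷ [] , K∈D ∷ [] , hull-⊇ y (here y∈K))) x x∈s)
      collect : ∀ zs → (∀ z → z ∈ₗ zs → FinitelyGenerated (proj₁ z)) →
        ∃ λ Ks → All (_∈ D) Ks × All (λ z → Hull (Member Ks) (proj₁ z)) zs
      collect []       _   = [] , [] , []
      collect (z ∷ zs) gen =
        let Ks , Ks∈D , hz   = gen z (here refl)
            Ks′ , Ks′∈D , hzs = collect zs (λ z → gen z ∘ there)
        in Ks ++ Ks′ , All.++⁺ Ks∈D Ks′∈D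
         , enlarge {Ks} {Ks ++ Ks′} (λ _ → Any.++⁺ˡ) hz
         ∷ All.map (enlarge {Ks′} {Ks ++ Ks′} (λ _ → Any.++⁺ʳ Ks)) hzs

    finiteClosureˢ : List Point → Poset.Carrier S
    finiteClosureˢ zs = finiteClosure zs , finiteClosure-compact zs

    -- With weights of sum 1, y is the same combination of its two expressions, so the displacements
    -- are averaged.
    behind-convex : ∀ d y → IsConvex (λ x → Ahead d x y)
    behind-convex d y = record
      { resp   = λ x≈x′ (t , 0≤t , y≈) → t , 0≤t , ≈ᴹ-trans y≈ (+ᴹ-cong x≈x′ ≈ᴹ-refl)
      ; convex = λ {x} {x′} (a , 0≤a , y≈) (a′ , 0≤a′ , y≈′) {s} {t} 0≤s 0≤t s+t≈1 →
          s * a + t * a′ , +-nonNeg (*-nonNeg 0≤s 0≤a) (*-nonNeg 0≤t 0≤a′) ,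
          ≈ᴹ-trans (≈ᴹ-sym (Module.*ₗ-identityˡ V y)) (≈ᴹ-trans (*ₗ-cong (≈-sym s+t≈1) ≈ᴹ-refl)
            (≈ᴹ-trans (proveᴹ (s ∷ t ∷ []) (y ∷ []) ((var 0F :+ var 1F) :• vec 0F)
                         (var 0F :• vec 0F :⊕ var 1F :• vec 0F) (≈-refl , tt))
            (≈ᴹ-trans (+ᴹ-cong (*ₗ-cong ≈-refl y≈) (*ₗ-cong ≈-refl y≈′))
              (proveᴹ (s ∷ t ∷ a ∷ a′ ∷ []) (x ∷ x′ ∷ d ∷ [])
                (var 0F :• (vec 0F :⊕ var 2F :• vec 2F) :⊕ var 1F :• (vec 1F :⊕ var 3F :• vec 2F))
                (var 0F :• vec 0F :⊕ var 1F :• vec 1F :⊕ (var 0F :* var 2F :+ var 1F :* var 3F) :• vec 2F)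
                (≈-refl , ≈-refl , ≈-refl , tt)))))
      }

    -- The segments from `f 0ℚ` to `f x` are shown to grow with x for positive x only, so the chain
    -- is indexed by a copy of ℚ among the positive rationals.
    positive-embedding : ∃ λ (g : ℚ → ℚ) → (∀ x → 0ℚ ℚ.< g x) × (∀ {x y} → x ℚ.< y → g x ℚ.< g y)
    positive-embedding =
      let g , g-mono = Cantor.cantor {A = ∃ (0ℚ ℚ.<_)} (ℚ._<_ on proj₁) ℚ.<-trans
            (λ {(x , 0<x)} x<y → let z , x<z , z<y = ℚ.<-dense x<y in (z , ℚ.<-trans 0<x x<z) , x<z , z<y)
            ( (ℚ.½ , ℚ.*<* (ℤ.+<+ (ℕ.s≤s ℕ.z≤n))) , (1ℚ , ℚ.*<* (ℤ.+<+ (ℕ.s≤s ℕ.z≤n)))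
            , ℚ.*<* (ℤ.+<+ (ℕ.s≤s (ℕ.s≤s ℕ.z≤n))))
      in proj₁ ∘ g , proj₂ ∘ g , g-mono

    compactsScattered⇒traceScattered : OrderScatteredPoset S → ∀ {l} (o : Orientation l) → TraceOrderScattered X o
    compactsScattered⇒traceScattered scattered {l} o (f , f-mono) = scattered
      (segment ∘ g , strict⇒orderMonomorphism (Poset.isEquivalence S)
        (λ {Y} {Z} → Poset.reflexive S {Y} {Z}) (segment ∘ g)
        λ {x} {y} x<y → segment-mono (g-positive x) (ℚ.<⇒≤ (g-mono x<y))
                      , λ le → ℚ-<⇒≱ (g-mono x<y) (segment-cancel (g-positive x) le))
      where
      open IsOrderMonomorphism f-mono
      open Poset S using () renaming (_≤_ to _≤ˢ_)
      d = Orientation.vector o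
      g = proj₁ positive-embedding
      g-positive = proj₁ (proj₂ positive-embedding)
      g-mono = proj₂ (proj₂ positive-embedding)
      point : ℚ → Point
      point x = proj₁ (f x) , proj₁ (proj₂ (f x))
      segment : ℚ → Poset.Carrier S
      segment x = finiteClosureˢ (point 0ℚ ∷ point x ∷ [])
      segment-mono : ∀ {x y} → 0ℚ ℚ.< x → x ℚ.≤ y → segment x ≤ˢ segment y
      segment-mono {x} {y} 0<x x≤y = closure-least (finiteClosure (point 0ℚ ∷ point y ∷ []))
        λ { _ (here refl)         → closure-⊇ (point 0ℚ) (here refl)
          ; _ (there (here refl)) → ∈-closure⁺ {Z = _∈ₗ (point 0ℚ ∷ point y ∷ [])} {point x}
              (between hull-convex
                (hull-⊇ {Z = _∈ₗ (point 0ℚ ∷ point y ∷ [])} (point 0ℚ) (here refl))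
                (hull-⊇ {Z = _∈ₗ (point 0ℚ ∷ point y ∷ [])} (point y) (there (here refl)))
                (mono (ℚ.<⇒≤ 0<x)) (mono x≤y)) }
      segment-cancel : ∀ {x y} → 0ℚ ℚ.< x → segment y ≤ˢ segment x → y ℚ.≤ x
      -- Both ends of the segment at x lie behind `f x`, hence so does its hull, to which `f y`
      -- belongs by assumption.
      segment-cancel {x} {y} 0<x y≤x = cancel (hull-least (behind-convex d (proj₁ (point x)))
        (λ { _ (here refl) → mono (ℚ.<⇒≤ 0<x) ; _ (there (here refl)) → ahead-0 ≈ᴹ-refl })
        (∈-closure⁻ {Z = _∈ₗ (point 0ℚ ∷ point x ∷ [])} {point y}
          (y≤x (point y) (closure-⊇ (point y) (there (here refl))))))

  -- Convexly independent sequences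

  -- That `y j` lies outside the hull of the other points is witnessed by a convex set separating it
  -- from them; a linear subspace or an open half of a flat serves below.
  ConvexlyIndependent : (ℕ → Carrierᴹ) → Set _
  ConvexlyIndependent y = ∀ j → ∃ λ (P : Pred Carrierᴹ (r ⊔ ℓr ⊔ m ⊔ ℓm)) →
    IsConvex P × (∀ i → ¬ i ≡ j → P (y i)) × ¬ P (y j)

  module _ (X : Subset ≈ᴹ-setoid) where

    open Lattice X

    -- If n is not in G, the convex set belonging to n contains all points with index in G, hence
    -- their hull, but not `y n`. So inclusion of closures forces inclusion of index sets.
    independent⇒𝒫<ω : (y : ℕ → Point) → ConvexlyIndependent (proj₁ ∘ y) → HasJoinSubsemilattice S 𝒫<ω
    independent⇒𝒫<ω y independent = f
      , record
          { isHomomorphism = record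
            { cong = λ {F} {G} (F⊆G , G⊆F) → Poset.antisym S {f F} {f G} (f-mono F⊆G) (f-mono G⊆F) }
          ; injective = λ {F} {G} fF≈fG →
              f-cancel (Poset.reflexive S {f F} {f G} fF≈fG) ,
              f-cancel (Poset.reflexive S {f G} {f F} (Poset.Eq.sym S {f F} {f G} fF≈fG))
          }
      , λ F G → f-mono (xs⊆xs++ys F G) , f-mono (xs⊆ys++xs G F) ,
          λ K fF≤K fG≤K → closure-least (proj₁ K) (λ x x∈ → join F G x x∈ K fF≤K fG≤K)
      where
      open Poset S using () renaming (_≤_ to _≤ˢ_)
      f : List ℕ → Poset.Carrier S
      f F = finiteClosureˢ (map y F)
      generator : ∀ {n} F → n ∈ₗ F → y n ∈ proj₁ (proj₁ (f F))
      generator {n} F n∈F = closure-⊇ (y n) (∈-map⁺ y n∈F)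
      f-mono : ∀ {F G} → F ⊆ G → f F ≤ˢ f G
      f-mono {F} {G} F⊆G = closure-least (finiteClosure (map y G))
        λ x x∈ → closure-⊇ x (map⁺ y F⊆G x∈)
      f-cancel : ∀ {F G} → f F ≤ˢ f G → F ⊆ G
      f-cancel {F} {G} fF≤fG {n} n∈F = byContradiction λ n∉G →
        let P , cvx , others , not-n = independent n
        in not-n (hull-least cvx
          (λ x x∈ → let i , i∈G , x≡ = ∈-map⁻ y x∈ in
            ≡.subst (P ∘ proj₁) (≡.sym x≡) (others i λ { refl → n∉G i∈G }))
          (∈-closure⁻ {Z = _∈ₗ map y G} {y n} (fF≤fG (y n) (generator F n∈F))))
      join : ∀ F G x → x ∈ₗ map y (F ++ G) → ∀ K → f F ≤ˢ K → f G ≤ˢ K → x ∈ proj₁ (proj₁ K)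
      join F G x x∈ K fF≤K fG≤K with ∈-map⁻ y x∈
      ... | n , n∈ , refl = [ (λ n∈F → fF≤K (y n) (generator F n∈F))
                            , (λ n∈G → fG≤K (y n) (generator G n∈G)) ]′ (∈-++⁻ F n∈)

-- Spans and linear independence

module VectorSequences (em : ∀ {ℓ} → ExcludedMiddle ℓ) {r ℓr m ℓm} (ℝ : Reals r ℓr)
                       (V : Module (Reals.commutativeRing ℝ) m ℓm) where

  open Classical em
  open VectorSpace ℝ V
  open Reals ℝ using () renaming (Carrier to Scalar)
  open Module V using (≈ᴹ-refl; ≈ᴹ-sym; ≈ᴹ-trans; +ᴹ-cong; *ₗ-cong; *ₗ-identityˡ; *ₗ-zeroˡ; +ᴹ-identityˡ; +ᴹ-identityʳ)
  open OrderedField em ℝ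
  open ScalarSequences em ℝ
  open Convexity em ℝ V
  open LinearSolver V using (proveᴹ; vec; _:⊕_; _:•_; :0ᴹ; var; _:+_; _:*_; _:-_; :-_; :1; :0; ⟦1⟧≈1; solve; _:=_)

  infixr 5 _∷_

  data Span : List Carrierᴹ → Pred Carrierᴹ (r ⊔ ℓr ⊔ m ⊔ ℓm) where
    []  : ∀ {x} → x ≈ᴹ 0ᴹ → Span [] x
    _∷_ : ∀ {v vs x t z} → x ≈ᴹ t *ₗ v +ᴹ z → Span vs z → Span (v ∷ vs) x

  Independent : List Carrierᴹ → Set (r ⊔ ℓr ⊔ m ⊔ ℓm)
  Independent []       = ⊤
  Independent (v ∷ vs) = ¬ Span vs v × Independent vs

  span-resp : ∀ {vs x y} → x ≈ᴹ y → Span vs x → Span vs y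
  span-resp x≈y ([] x≈)   = [] (≈ᴹ-trans (≈ᴹ-sym x≈y) x≈)
  span-resp x≈y (x≈ ∷ sz) = ≈ᴹ-trans (≈ᴹ-sym x≈y) x≈ ∷ sz

  span-linear : ∀ s t {vs x y} → Span vs x → Span vs y → Span vs (s *ₗ x +ᴹ t *ₗ y)
  span-linear s t ([] x≈0) ([] y≈0) = [] (≈ᴹ-trans (+ᴹ-cong (*ₗ-cong ≈-refl x≈0) (*ₗ-cong ≈-refl y≈0))
    (proveᴹ (s ∷ t ∷ []) [] (var 0F :• :0ᴹ :⊕ var 1F :• :0ᴹ) :0ᴹ tt))
  span-linear s t (_∷_ {v = v} {t = a} {z} x≈ sz) (_∷_ {t = b} {z′} y≈ sz′) =
    ≈ᴹ-trans (+ᴹ-cong (*ₗ-cong ≈-refl x≈) (*ₗ-cong ≈-refl y≈))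
      (proveᴹ (s ∷ t ∷ a ∷ b ∷ []) (v ∷ z ∷ z′ ∷ [])
        (var 0F :• (var 2F :• vec 0F :⊕ vec 1F) :⊕ var 1F :• (var 3F :• vec 0F :⊕ vec 2F))
        ((var 0F :* var 2F :+ var 1F :* var 3F) :• vec 0F :⊕ (var 0F :• vec 1F :⊕ var 1F :• vec 2F))
        (≈-refl , ≈-refl , ≈-refl , tt))
    ∷ span-linear s t sz sz′

  span-scale : ∀ t {vs x} → Span vs x → Span vs (t *ₗ x)
  span-scale t {x = x} sx = span-resp
    (proveᴹ (t ∷ []) (x ∷ []) (var 0F :• vec 0F :⊕ :0 :• vec 0F) (var 0F :• vec 0F) (≈-refl , tt))
    (span-linear t (0# - 0#) sx sx)

  span-0 : ∀ vs → Span vs 0ᴹ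
  span-0 []       = [] ≈ᴹ-refl
  span-0 (v ∷ vs) = proveᴹ [] (v ∷ []) :0ᴹ (:0 :• vec 0F :⊕ :0ᴹ) (≈-refl , tt) ∷ span-0 vs

  span-tail : ∀ {v vs x} → Span vs x → Span (v ∷ vs) x
  span-tail {v} {x = x} sx = proveᴹ [] (v ∷ x ∷ []) (vec 1F) (:0 :• vec 0F :⊕ vec 1F) (≈-refl , ≈-refl , tt) ∷ sx

  span-head : ∀ {v vs} → Span (v ∷ vs) v
  span-head {v} {vs} = proveᴹ [] (v ∷ []) (vec 0F) (:1 :• vec 0F :⊕ :0ᴹ) (≈-refl , tt) ∷ span-0 vs

  span-cons-mono : ∀ {v vs ws} → (∀ {x} → Span vs x → Span ws x) → ∀ {x} → Span (v ∷ vs) x → Span (v ∷ ws) x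
  span-cons-mono vs⊆ws (x≈ ∷ sz) = x≈ ∷ vs⊆ws sz

  span-divide : ∀ {vs t x} → ¬ t ≈ 0# → Span vs (t *ₗ x) → Span vs x
  span-divide {t = t} {x} t≉0 stx =
    let u , tu≈1 = invertible t t≉0
    in span-resp (≈ᴹ-trans
         (proveᴹ (t ∷ u ∷ []) (x ∷ []) (var 1F :• var 0F :• vec 0F) ((var 0F :* var 1F) :• vec 0F) (≈-refl , tt))
         (≈ᴹ-trans (*ₗ-cong tu≈1 ≈ᴹ-refl) (*ₗ-identityˡ x)))
       (span-scale u stx)

  coefficient-0 : ∀ {vs t x} → ¬ Span vs x → Span vs (t *ₗ x) → t ≈ 0#
  coefficient-0 x∉ stx = byContradiction λ t≉0 → x∉ (span-divide t≉0 stx)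

  module _ (x : ℕ → Carrierᴹ) where

    initial : ℕ → List Carrierᴹ
    initial zero    = []
    initial (suc n) = x n ∷ initial n

    -- The initial list of length k + j + 1 without `x j`, in the same order.
    omitting : ℕ → ℕ → List Carrierᴹ
    omitting j zero    = initial j
    omitting j (suc k) = x (k ℕ.+ suc j) ∷ omitting j k

    omitting⊆initial : ∀ j k {y} → Span (omitting j k) y → Span (initial (k ℕ.+ suc j)) y
    omitting⊆initial j zero    = span-tail
    omitting⊆initial j (suc k) = span-cons-mono (omitting⊆initial j k)

    initial-mono : ∀ {m n} → m ℕ.≤′ n → ∀ {y} → Span (initial m) y → Span (initial n) y
    initial-mono ℕ.≤′-refl       = id
    initial-mono (ℕ.≤′-step m≤n) = span-tail ∘ initial-mono m≤n

    omitting-mono : ∀ j {k l} → k ℕ.≤′ l → ∀ {y} → Span (omitting j k) y → Span (omitting j l) y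
    omitting-mono j ℕ.≤′-refl       = id
    omitting-mono j (ℕ.≤′-step k≤l) = span-tail ∘ omitting-mono j k≤l

    ∈-initial : ∀ {m n} → m ℕ.< n → Span (initial n) (x m)
    ∈-initial m<n = initial-mono (ℕ.≤⇒≤′ m<n) span-head

    -- Exchange argument: a nonzero coefficient at the latest generator would put that generator in
    -- the span of the earlier vectors, among them `x j`. So the coefficient vanishes and the list
    -- can be shortened.
    omitted : (∀ n → ¬ Span (initial n) (x n)) → ∀ j k → ¬ Span (omitting j k) (x j)
    omitted x∉ j zero    sx = x∉ j sx
    omitted x∉ j (suc k) (_∷_ {t = t} {z} x≈ sz) = omitted x∉ j k (span-resp (≈ᴹ-sym xj≈z) sz)
      where
      n = k ℕ.+ suc j
      t≈0 : t ≈ 0#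
      t≈0 = coefficient-0 (x∉ n) (span-resp
        (≈ᴹ-trans (+ᴹ-cong (*ₗ-cong ≈-refl x≈) ≈ᴹ-refl)
          (proveᴹ (t ∷ []) (x n ∷ z ∷ [])
            (:1 :• (var 0F :• vec 0F :⊕ vec 1F) :⊕ (:- :1) :• vec 1F) (var 0F :• vec 0F) (≈-refl , ≈-refl , tt)))
        (span-linear _ _ (∈-initial (ℕ.m≤n+m (suc j) k)) (omitting⊆initial j k sz)))
      xj≈z : x j ≈ᴹ z
      xj≈z = ≈ᴹ-trans x≈ (≈ᴹ-trans (+ᴹ-cong (≈ᴹ-trans (*ₗ-cong t≈0 ≈ᴹ-refl) (*ₗ-zeroˡ (x n))) ≈ᴹ-refl) (+ᴹ-identityˡ z))

    -- The separating convex set is the linear span of all the other vectors.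
    linearlyIndependent⇒convexlyIndependent : (∀ n → ¬ Span (initial n) (x n)) → ConvexlyIndependent x
    linearlyIndependent⇒convexlyIndependent x∉ j =
      Others , record
        { resp   = λ y≈z → map₂ (span-resp y≈z)
        ; convex = λ (k , sy) (l , sz) {s} {t} _ _ _ → k ℕ.⊔ l , span-linear s t
            (omitting-mono j (ℕ.≤⇒≤′ (ℕ.m≤m⊔n k l)) sy) (omitting-mono j (ℕ.≤⇒≤′ (ℕ.m≤n⊔m k l)) sz)
        }
      , others , λ (k , sx) → omitted x∉ j k sx
      where
      Others : Pred Carrierᴹ _
      Others y = ∃ λ k → Span (omitting j k) y
      others : ∀ i → ¬ i ≡ j → Others (x i)
      others i i≢j with ℕ.<-cmp i j
      ... | tri< i<j _ _ = 0 , ∈-initial i<j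
      ... | tri≈ _ i≡j _ = contradiction i≡j i≢j
      ... | tri> _ _ j<i = suc (i ℕ.∸ suc j) , ≡.subst (λ n → Span (omitting j (suc (i ℕ.∸ suc j))) (x n))
        (ℕ.m∸n+n≡m j<i) span-head

  -- The separating set is the open half-plane above the supporting line of slope μ, in the
  -- coordinates t and s, taken modulo the span of `vs`. Independence makes these coordinates
  -- unique, so `x j` itself is not strictly above the line.
  supported⇒convexlyIndependent : ∀ {w v vs} → Independent (w ∷ v ∷ vs) → ∀ {p t s x} →
    (∀ n → ∃ λ z → Span vs z × x n ≈ᴹ (p +ᴹ t n *ₗ w) +ᴹ (s n *ₗ v +ᴹ z)) →
    Supported t s → ConvexlyIndependent x
  supported⇒convexlyIndependent {w} {v} {vs} (w∉ , v∉ , _) {p} {t} {s} {x} coords supported j =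
    Above , record { resp = above-resp ; convex = above-convex } , others , excluded
    where
    μ = proj₁ (supported j)
    Above : Pred Carrierᴹ _
    Above y = ∃₂ λ a b → ∃ λ z → Span vs z × y ≈ᴹ (p +ᴹ a *ₗ w) +ᴹ (b *ₗ v +ᴹ z) × s j - μ * t j < b - μ * a
    above-resp : ∀ {y y′} → y ≈ᴹ y′ → Above y → Above y′
    above-resp y≈y′ (a , b , z , sz , y≈ , lt) = a , b , z , sz , ≈ᴹ-trans (≈ᴹ-sym y≈y′) y≈ , lt
    above-convex : ∀ {y y′} → Above y → Above y′ → ∀ {c d} → 0# ≤ c → 0# ≤ d → c + d ≈ 1# →
      Above (c *ₗ y +ᴹ d *ₗ y′)
    above-convex (a , b , z , sz , y≈ , lt) (a′ , b′ , z′ , sz′ , y≈′ , lt′) {c} {d} 0≤c 0≤d c+d≈1 =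
      c * a + d * a′ , c * b + d * b′ , c *ₗ z +ᴹ d *ₗ z′ , span-linear c d sz sz′
      , ≈ᴹ-trans (+ᴹ-cong (*ₗ-cong ≈-refl y≈) (*ₗ-cong ≈-refl y≈′)) (≈ᴹ-trans
          (proveᴹ (a ∷ b ∷ a′ ∷ b′ ∷ c ∷ d ∷ []) (p ∷ w ∷ v ∷ z ∷ z′ ∷ [])
            (var 4F :• ((vec 0F :⊕ var 0F :• vec 1F) :⊕ (var 1F :• vec 2F :⊕ vec 3F)) :⊕
             var 5F :• ((vec 0F :⊕ var 2F :• vec 1F) :⊕ (var 3F :• vec 2F :⊕ vec 4F)))
            (((var 4F :+ var 5F) :• vec 0F :⊕ (var 4F :* var 0F :+ var 5F :* var 2F) :• vec 1F) :⊕
             ((var 4F :* var 1F :+ var 5F :* var 3F) :• vec 2F :⊕ (var 4F :• vec 3F :⊕ var 5F :• vec 4F)))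
            (≈-refl , ≈-refl , ≈-refl , ≈-refl , ≈-refl , tt))
          (+ᴹ-cong (+ᴹ-cong (≈ᴹ-trans (*ₗ-cong c+d≈1 ≈ᴹ-refl) (*ₗ-identityˡ p)) ≈ᴹ-refl) ≈ᴹ-refl))
      , <-≤-trans (convex-above 0≤c 0≤d c+d≈1 lt lt′) (≤-reflexive
          (solve 7 (λ a b a′ b′ c d μ → c :* (b :- μ :* a) :+ d :* (b′ :- μ :* a′) :=
              (c :* b :+ d :* b′) :- μ :* (c :* a :+ d :* a′)) ≈-refl a b a′ b′ c d μ))
    others : ∀ i → ¬ i ≡ j → Above (x i)
    others i i≢j = let z , sz , x≈ = coords i in t i , s i , z , sz , x≈ , proj₂ (supported j) i i≢j
    excluded : ¬ Above (x j)
    excluded (a , b , z , sz , x≈ , lt) = <⇒≉ lt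
      (+-cong (x∙y⁻¹≈ε⇒x≈y _ _ s-b≈0) (-‿cong (*-congˡ (x∙y⁻¹≈ε⇒x≈y _ _ t-a≈0))))
      where
      open import Algebra.Properties.Group +-group using (x∙y⁻¹≈ε⇒x≈y)
      zⱼ = proj₁ (coords j)
      same : (p +ᴹ t j *ₗ w) +ᴹ (s j *ₗ v +ᴹ zⱼ) ≈ᴹ (p +ᴹ a *ₗ w) +ᴹ (b *ₗ v +ᴹ z)
      same = ≈ᴹ-trans (≈ᴹ-sym (proj₂ (proj₂ (coords j)))) x≈
      -- Written in the form to which the solver evaluates `:- :1`.
      -1* = - (1# + 0# - 0#)
      Δz : Span vs (-1* *ₗ zⱼ +ᴹ (1# + 0# - 0#) *ₗ z)
      Δz = span-linear _ _ (proj₁ (proj₂ (coords j))) sz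
      ρ = t j ∷ s j ∷ a ∷ b ∷ []
      σ = p ∷ w ∷ v ∷ zⱼ ∷ z ∷ []
      -- Subtracting the two expressions of `x j` leaves a multiple of w in the span of v and vs;
      -- once its coefficient is zero, the same argument applies to v.
      t-a≈0 : t j - a ≈ 0#
      t-a≈0 = coefficient-0 w∉ (≈ᴹ-trans
        (≈ᴹ-trans
          (proveᴹ ρ σ ((var 0F :- var 2F) :• vec 1F)
            (((vec 0F :⊕ var 0F :• vec 1F) :⊕ (var 1F :• vec 2F :⊕ vec 3F)) :⊕
             (:- :1) :• ((vec 0F :⊕ var 2F :• vec 1F) :⊕ (var 1F :• vec 2F :⊕ vec 3F)))
            (≈-refl , ≈-refl , ≈-refl , ≈-refl , ≈-refl , tt))
          (+ᴹ-cong same ≈ᴹ-refl))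
        (proveᴹ ρ σ
          (((vec 0F :⊕ var 2F :• vec 1F) :⊕ (var 3F :• vec 2F :⊕ vec 4F)) :⊕
             (:- :1) :• ((vec 0F :⊕ var 2F :• vec 1F) :⊕ (var 1F :• vec 2F :⊕ vec 3F)))
          ((var 3F :- var 1F) :• vec 2F :⊕ ((:- :1) :• vec 3F :⊕ :1 :• vec 4F))
          (≈-refl , ≈-refl , ≈-refl , ≈-refl , ≈-refl , tt))
        ∷ Δz)
      s-b≈0 : s j - b ≈ 0#
      s-b≈0 = coefficient-0 v∉ (span-resp (≈ᴹ-sym (≈ᴹ-trans
        (≈ᴹ-trans
          (proveᴹ ρ σ ((var 1F :- var 3F) :• vec 2F)
            (((vec 0F :⊕ var 0F :• vec 1F) :⊕ (var 1F :• vec 2F :⊕ vec 3F)) :⊕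
             (:- :1) :• ((vec 0F :⊕ var 0F :• vec 1F) :⊕ (var 3F :• vec 2F :⊕ vec 3F)))
            (≈-refl , ≈-refl , ≈-refl , ≈-refl , ≈-refl , tt))
          (+ᴹ-cong same ≈ᴹ-refl))
        (≈ᴹ-trans
          (proveᴹ ρ σ
            (((vec 0F :⊕ var 2F :• vec 1F) :⊕ (var 3F :• vec 2F :⊕ vec 4F)) :⊕
             (:- :1) :• ((vec 0F :⊕ var 0F :• vec 1F) :⊕ (var 3F :• vec 2F :⊕ vec 3F)))
            (((:- :1) :• vec 3F :⊕ :1 :• vec 4F) :⊕ (:- :1) :• (var 0F :- var 2F) :• vec 1F)
            (≈-refl , ≈-refl , ≈-refl , ≈-refl , ≈-refl , tt))
          (≈ᴹ-trans (+ᴹ-cong ≈ᴹ-refl (*ₗ-cong ≈-refl (≈ᴹ-trans (*ₗ-cong t-a≈0 ≈ᴹ-refl) (*ₗ-zeroˡ w))))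
            (proveᴹ ρ σ (((:- :1) :• vec 3F :⊕ :1 :• vec 4F) :⊕ (:- :1) :• :0ᴹ)
              ((:- :1) :• vec 3F :⊕ :1 :• vec 4F)
              (≈-refl , ≈-refl , ≈-refl , ≈-refl , ≈-refl , tt)))))) Δz)

  -- Non-collinear points in finite dimension

  NonCollinear : (ℕ → Carrierᴹ) → Set _
  NonCollinear x = (∀ {i j} → i ℕ.< j → ¬ x i ≈ᴹ x j) ×
    (∀ {i j k} → i ℕ.< j → j ℕ.< k → ∀ a → ¬ x k ≈ᴹ x i +ᴹ a *ₗ (x j +ᴹ (- 1#) *ₗ x i))

  nonCollinear-thin : ∀ {x} (g : Subsequence) → NonCollinear x → NonCollinear (λ n → x (g ‼ n))
  nonCollinear-thin (_ , inc) (distinct , off) = distinct ∘ inc , λ i<j j<k → off (inc i<j) (inc j<k)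

  -- Three points suffice: `x 2` lies on the line through `x 0` and `x 1`, at the parameter (t 2 - t
  -- 0) / (t 1 - t 0).
  affine⇒collinear : ∀ {p w t x} → StrictlyIncreasing t → (∀ n → x n ≈ᴹ p +ᴹ t n *ₗ w) → ¬ NonCollinear x
  affine⇒collinear {p} {w} {t} {x} t-inc x≈ (_ , off) =
    off {0} {1} {2} (ℕ.s≤s ℕ.z≤n) (ℕ.s≤s (ℕ.s≤s ℕ.z≤n)) (Δ * u)
      (≈ᴹ-trans (x≈ 2) (≈ᴹ-trans lhs (≈ᴹ-sym (+ᴹ-cong (x≈ 0)
        (*ₗ-cong ≈-refl (+ᴹ-cong (x≈ 1) (*ₗ-cong (-‿cong (≈-sym ⟦1⟧≈1)) (x≈ 0))))))))
    where
    t₁-t₀≉0 : ¬ t 1 - t 0 ≈ 0#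
    t₁-t₀≉0 = <⇒≉ (<⇒0<- (t-inc (ℕ.s≤s ℕ.z≤n))) ∘ ≈-sym
    u = proj₁ (invertible (t 1 - t 0) t₁-t₀≉0)
    Δ = t 2 - t 0
    lhs : p +ᴹ t 2 *ₗ w ≈ᴹ (p +ᴹ t 0 *ₗ w) +ᴹ (Δ * u) *ₗ ((p +ᴹ t 1 *ₗ w) +ᴹ (- (1# + 0# - 0#)) *ₗ (p +ᴹ t 0 *ₗ w))
    lhs = ≈ᴹ-trans
      (proveᴹ (t 0 ∷ t 2 ∷ []) (p ∷ w ∷ []) (vec 0F :⊕ var 1F :• vec 1F)
        ((vec 0F :⊕ var 0F :• vec 1F) :⊕ ((var 1F :- var 0F) :* :1) :• vec 1F) (≈-refl , ≈-refl , tt))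
      (≈ᴹ-trans
        (+ᴹ-cong ≈ᴹ-refl (*ₗ-cong (*-congˡ (≈-trans ⟦1⟧≈1 (≈-sym (proj₂ (invertible (t 1 - t 0) t₁-t₀≉0))))) ≈ᴹ-refl))
        (proveᴹ (t 0 ∷ t 1 ∷ t 2 ∷ u ∷ []) (p ∷ w ∷ [])
          ((vec 0F :⊕ var 0F :• vec 1F) :⊕ ((var 2F :- var 0F) :* ((var 1F :- var 0F) :* var 3F)) :• vec 1F)
          ((vec 0F :⊕ var 0F :• vec 1F) :⊕ ((var 2F :- var 0F) :* var 3F) :•
            ((vec 0F :⊕ var 1F :• vec 1F) :⊕ (:- :1) :• (vec 0F :⊕ var 0F :• vec 1F)))
          (≈-refl , ≈-refl , tt)))

  HasIndependentSubsequence : (ℕ → Carrierᴹ) → Set _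
  HasIndependentSubsequence x = ∃ λ (g : Subsequence) → ConvexlyIndependent (λ n → x (g ‼ n))

  negate : Carrierᴹ → Carrierᴹ
  negate v = (- 1#) *ₗ v

  negate-negate : ∀ v → v ≈ᴹ (- 1#) *ₗ negate v
  negate-negate v = ≈ᴹ-trans
    (proveᴹ [] (v ∷ []) (vec 0F) ((:- :1) :• (:- :1) :• vec 0F) (≈-refl , tt))
    (*ₗ-cong (-‿cong ⟦1⟧≈1) (*ₗ-cong (-‿cong ⟦1⟧≈1) ≈ᴹ-refl))

  scale-negate : ∀ t v → t *ₗ v ≈ᴹ (- t) *ₗ negate v
  scale-negate t v = ≈ᴹ-trans
    (proveᴹ (t ∷ []) (v ∷ []) (var 0F :• vec 0F) ((:- var 0F) :• (:- :1) :• vec 0F) (≈-refl , tt))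
    (*ₗ-cong ≈-refl (*ₗ-cong (-‿cong ⟦1⟧≈1) ≈ᴹ-refl))

  span-negate : ∀ {vs v} → ¬ Span vs v → ¬ Span vs (negate v)
  span-negate {v = v} v∉ s-v = v∉ (span-resp (≈ᴹ-sym (negate-negate v)) (span-scale (- 1#) s-v))

  span-negate-head : ∀ {v vs x} → Span (negate v ∷ vs) x → Span (v ∷ vs) x
  span-negate-head {v} (_∷_ {t = t} x≈ sz) = ≈ᴹ-trans x≈ (+ᴹ-cong (≈ᴹ-trans
    (*ₗ-cong ≈-refl (*ₗ-cong (-‿cong (≈-sym ⟦1⟧≈1)) ≈ᴹ-refl))
    (proveᴹ (t ∷ []) (v ∷ []) (var 0F :• (:- :1) :• vec 0F) ((:- var 0F) :• vec 0F) (≈-refl , tt))) ≈ᴹ-refl) ∷ sz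

  -- The coordinate along w stays strictly increasing. When the next coordinate is a t + b, the
  -- vector v is absorbed by passing to w + a v and p + b v, and fewer coordinates are left; with
  -- none left, the points lie on a line.
  monotone-case : ∀ vs {w p t x} → Independent (w ∷ vs) → StrictlyIncreasing t →
    (∀ n → ∃ λ z → Span vs z × x n ≈ᴹ (p +ᴹ t n *ₗ w) +ᴹ z) → NonCollinear x → HasIndependentSubsequence x
  monotone-case [] _ t-inc coords nc = contradiction nc (affine⇒collinear t-inc line)
    where
    line : ∀ n → _
    line n with coords n
    ... | z , [] z≈0 , x≈ = ≈ᴹ-trans x≈ (≈ᴹ-trans (+ᴹ-cong ≈ᴹ-refl z≈0) (+ᴹ-identityʳ _))
  monotone-case (v ∷ vs) {w} {p} {t} {x} (w∉ , v∉ , vs-independent) t-inc coords nc =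
    classify (cup-cap-or-line t s t-inc)
    where
    split : ∀ n → ∃₂ λ s z → Span vs z × x n ≈ᴹ (p +ᴹ t n *ₗ w) +ᴹ (s *ₗ v +ᴹ z)
    split n with coords n
    ... | _ , (_∷_ {t = s} {z} z≈ sz) , x≈ = s , z , sz , ≈ᴹ-trans x≈ (+ᴹ-cong ≈ᴹ-refl z≈)
    s : ℕ → Scalar
    s n = proj₁ (split n)
    w+av∉ : ∀ a → ¬ Span vs (w +ᴹ a *ₗ v)
    w+av∉ a sp = w∉ (proveᴹ (a ∷ []) (w ∷ v ∷ []) (vec 0F)
      ((:- var 0F) :• vec 1F :⊕ (vec 0F :⊕ var 0F :• vec 1F)) (≈-refl , ≈-refl , tt) ∷ sp)
    classify : (∃ λ (g : Subsequence) → let t′ = λ n → t (g ‼ n) ; s′ = λ n → s (g ‼ n) in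
      Supported t′ s′ ⊎ Supported t′ (λ n → - s′ n) ⊎ ∃₂ λ a b → ∀ n → s′ n ≈ a * t′ n + b) →
      HasIndependentSubsequence x
    classify (g , inj₁ cup) = g ,
      supported⇒convexlyIndependent (w∉ , v∉ , vs-independent) (λ n → proj₂ (split (g ‼ n))) cup
    -- With -v in place of v, the cap becomes a cup.
    classify (g , inj₂ (inj₁ cap)) = g ,
      supported⇒convexlyIndependent (w∉ ∘ span-negate-head , span-negate v∉ , vs-independent)
        (λ n → let _ , z , sz , x≈ = split (g ‼ n)
               in z , sz , ≈ᴹ-trans x≈ (+ᴹ-cong ≈ᴹ-refl (+ᴹ-cong (scale-negate (s (g ‼ n)) v) ≈ᴹ-refl))) cap
    classify (g , inj₂ (inj₂ (a , b , s≈))) =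
      let h , independent = monotone-case vs {w +ᴹ a *ₗ v} {p +ᴹ b *ₗ v} {λ n → t (g ‼ n)} {λ n → x (g ‼ n)}
            (w+av∉ a , vs-independent) (λ i<j → t-inc (proj₂ g i<j))
            (λ n → let _ , z , sz , x≈ = split (g ‼ n) in z , sz ,
              ≈ᴹ-trans x≈ (≈ᴹ-trans (+ᴹ-cong ≈ᴹ-refl (+ᴹ-cong (*ₗ-cong (s≈ n) ≈ᴹ-refl) ≈ᴹ-refl))
                (proveᴹ (a ∷ b ∷ t (g ‼ n) ∷ []) (p ∷ w ∷ v ∷ z ∷ [])
                  ((vec 0F :⊕ var 2F :• vec 1F) :⊕ ((var 0F :* var 2F :+ var 1F) :• vec 2F :⊕ vec 3F))
                  (((vec 0F :⊕ var 1F :• vec 2F) :⊕ var 2F :• (vec 1F :⊕ var 0F :• vec 2F)) :⊕ vec 3F)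
                  (≈-refl , ≈-refl , ≈-refl , ≈-refl , tt))))
            (nonCollinear-thin g nc)
      in g ⊚ h , independent

  -- A coordinate that becomes constant after thinning is absorbed in p. A decreasing one is made
  -- increasing by negating its basis vector, which leads to `monotone-case`. If all coordinates
  -- were absorbed, the points would coincide.
  finite-dimensional-case : ∀ vs {p x} → Independent vs →
    (∀ n → ∃ λ z → Span vs z × x n ≈ᴹ p +ᴹ z) → NonCollinear x → HasIndependentSubsequence x
  finite-dimensional-case [] {p} {x} _ coords (distinct , _) =
    contradiction (≈ᴹ-trans (constant 0) (≈ᴹ-sym (constant 1))) (distinct (ℕ.s≤s ℕ.z≤n))
    where
    constant : ∀ n → x n ≈ᴹ p
    constant n with coords n
    ... | z , [] z≈0 , x≈ = ≈ᴹ-trans x≈ (≈ᴹ-trans (+ᴹ-cong ≈ᴹ-refl z≈0) (+ᴹ-identityʳ p))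
  finite-dimensional-case (v ∷ vs) {p} {x} (v∉ , vs-independent) coords nc = classify (trend-subsequence t)
    where
    split : ∀ n → ∃₂ λ t z → Span vs z × x n ≈ᴹ (p +ᴹ t *ₗ v) +ᴹ z
    split n with coords n
    ... | _ , (_∷_ {t = t} {z} z≈ sz) , x≈ = t , z , sz , ≈ᴹ-trans x≈ (≈ᴹ-trans (+ᴹ-cong ≈ᴹ-refl z≈)
      (proveᴹ (t ∷ []) (p ∷ v ∷ z ∷ []) (vec 0F :⊕ (var 0F :• vec 1F :⊕ vec 2F))
        ((vec 0F :⊕ var 0F :• vec 1F) :⊕ vec 2F) (≈-refl , ≈-refl , ≈-refl , tt)))
    t : ℕ → Scalar
    t n = proj₁ (split n)
    thinned : ∀ g → HasIndependentSubsequence (λ n → x (g ‼ n)) → HasIndependentSubsequence x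
    thinned g (h , independent) = g ⊚ h , independent
    classify : (∃ λ (g : Subsequence) → Trend (λ n → t (g ‼ n))) → HasIndependentSubsequence x
    classify (g , inj₁ inc) = thinned g (monotone-case vs (v∉ , vs-independent) inc
      (λ n → proj₂ (split (g ‼ n))) (nonCollinear-thin g nc))
    classify (g , inj₂ (inj₁ dec)) = thinned g (monotone-case vs {negate v} {p} {λ n → - t (g ‼ n)}
      (span-negate v∉ , vs-independent) (λ i<j → neg-mono-< (dec i<j))
      (λ n → let _ , z , sz , x≈ = split (g ‼ n) in z , sz ,
        ≈ᴹ-trans x≈ (+ᴹ-cong (+ᴹ-cong ≈ᴹ-refl (scale-negate (t (g ‼ n)) v)) ≈ᴹ-refl))
      (nonCollinear-thin g nc))
    classify (g , inj₂ (inj₂ const)) = thinned g (finite-dimensional-case vs {p +ᴹ t (g ‼ 0) *ₗ v} vs-independent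
      (λ n → let _ , z , sz , x≈ = split (g ‼ n) in z , sz ,
        ≈ᴹ-trans x≈ (+ᴹ-cong (+ᴹ-cong ≈ᴹ-refl (*ₗ-cong (t≈t₀ n) ≈ᴹ-refl)) ≈ᴹ-refl))
      (nonCollinear-thin g nc))
      where
      t≈t₀ : ∀ n → t (g ‼ n) ≈ t (g ‼ 0)
      t≈t₀ zero    = ≈-refl
      t≈t₀ (suc n) = ≈-sym (const (ℕ.s≤s ℕ.z≤n))

  -- Greedy choice of a sequence in X

  module Greedy (v₀ : Carrierᴹ) (v₀≉0 : ¬ v₀ ≈ᴹ 0ᴹ) (X : Subset ≈ᴹ-setoid)
                (uncovered : ∀ ls → ¬ (∀ x → x ∈ X → Any (x on-line_) ls)) where

    -- The superfluous scalar 0# below makes the solver cancel 1 - 1: without scalar variables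
    -- it compares constants syntactically.
    direction : ∀ p q → ∃ λ d → ¬ d ≈ᴹ 0ᴹ × (¬ p ≈ᴹ q → d ≡ q +ᴹ (- 1#) *ₗ p)
    direction p q with em {P = q +ᴹ (- 1#) *ₗ p ≈ᴹ 0ᴹ}
    ... | no  q-p≉0 = q +ᴹ (- 1#) *ₗ p , q-p≉0 , λ _ → refl
    ... | yes q-p≈0 = v₀ , v₀≉0 , contradiction (≈ᴹ-sym (≈ᴹ-trans
      (≈ᴹ-trans (proveᴹ (0# ∷ []) (p ∷ q ∷ []) (vec 1F) (vec 0F :⊕ (vec 1F :⊕ (:- :1) :• vec 0F)) (≈-refl , ≈-refl , tt))
        (+ᴹ-cong ≈ᴹ-refl (+ᴹ-cong ≈ᴹ-refl (*ₗ-cong (-‿cong ⟦1⟧≈1) ≈ᴹ-refl))))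
      (≈ᴹ-trans (+ᴹ-cong ≈ᴹ-refl q-p≈0) (+ᴹ-identityʳ p))))

    -- If p ≈ q this is some line through p.
    lineThrough : Carrierᴹ → Carrierᴹ → Line
    lineThrough p q = record
      { point = p ; direction = proj₁ (direction p q) ; nonzero = proj₁ (proj₂ (direction p q)) }

    lines : List Carrierᴹ → List Line
    lines ps = cartesianProductWith lineThrough ps ps

    pick : ∀ ps → ∃ λ x → x ∈ X × ¬ Any (x on-line_) (lines ps)
    pick ps = byContradiction λ none → uncovered (lines ps) λ x x∈X →
      byContradiction λ off → none (x , x∈X , off)

    chosen : ℕ → List Carrierᴹ
    chosen zero    = []
    chosen (suc n) = proj₁ (pick (chosen n)) ∷ chosen n

    y : ℕ → Carrierᴹ
    y n = proj₁ (pick (chosen n))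

    y∈chosen : ∀ {i n} → i ℕ.<′ n → y i ∈ₗ chosen n
    y∈chosen ℕ.≤′-refl       = here refl
    y∈chosen (ℕ.≤′-step i<n) = there (y∈chosen i<n)

    y-off : ∀ {i j k} → i ℕ.< k → j ℕ.< k → ¬ y k on-line lineThrough (y i) (y j)
    y-off {k = k} i<k j<k on = proj₂ (proj₂ (pick (chosen k)))
      (lose (∈-cartesianProductWith⁺ lineThrough (y∈chosen (ℕ.≤⇒≤′ i<k)) (y∈chosen (ℕ.≤⇒≤′ j<k))) on)

    -- The pairs of earlier points include each point paired with itself, so some line through `y i`
    -- has been avoided; parameter 0 on it is the point `y i`.
    y-distinct : ∀ {i j} → i ℕ.< j → ¬ y i ≈ᴹ y j
    y-distinct {i} {j} i<j yi≈yj = y-off i<j i<j (0# , ≈ᴹ-trans (≈ᴹ-sym yi≈yj)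
      (≈ᴹ-sym (≈ᴹ-trans (+ᴹ-cong ≈ᴹ-refl (*ₗ-zeroˡ _)) (+ᴹ-identityʳ (y i)))))

    y-nonCollinear : NonCollinear y
    y-nonCollinear = y-distinct , λ {i} {j} {k} i<j j<k a yk≈ → y-off (ℕ.<-trans i<j j<k) j<k
      (a , ≡.subst (λ d → y k ≈ᴹ y i +ᴹ a *ₗ d)
             (≡.sym (proj₂ (proj₂ (direction (y i) (y j))) (y-distinct i<j))) yk≈)

    module InfiniteDimensional
      (unspanned : ∀ vs → Independent vs → ∃ λ x → x ∈ X × ¬ Span vs x) where

      basis : ℕ → ∃ Independent
      basis zero    = [] , tt
      basis (suc n) = let vs , independent = basis n ; x , _ , x∉ = unspanned vs independent
                      in x ∷ vs , x∉ , independent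

      next : ∀ n → ∃ λ x → x ∈ X × ¬ Span (proj₁ (basis n)) x
      next n = unspanned (proj₁ (basis n)) (proj₂ (basis n))

      e : ℕ → Carrierᴹ
      e n = proj₁ (next n)

      initial≡basis : ∀ n → initial e n ≡ proj₁ (basis n)
      initial≡basis zero    = refl
      initial≡basis (suc n) = ≡.cong (e n ∷_) (initial≡basis n)

      e-independent : ConvexlyIndependent e
      e-independent = linearlyIndependent⇒convexlyIndependent e λ n →
        ≡.subst (λ vs → ¬ Span vs (e n)) (≡.sym (initial≡basis n)) (proj₂ (proj₂ (next n)))

    convexlyIndependentSequence : ∃ λ (x : ℕ → ∃ (_∈ X)) → ConvexlyIndependent (proj₁ ∘ x)
    convexlyIndependentSequence with em {P = ∃ λ vs → Independent vs × (∀ x → x ∈ X → Span vs x)}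
    ... | yes (vs , independent , spans) =
      let g , y-independent = finite-dimensional-case vs {0ᴹ} {y} independent
            (λ n → y n , spans (y n) (y∈X n) , ≈ᴹ-sym (+ᴹ-identityˡ (y n))) y-nonCollinear
      in (λ n → y (g ‼ n) , y∈X (g ‼ n)) , y-independent
      where
      y∈X : ∀ n → y n ∈ X
      y∈X n = proj₁ (proj₂ (pick (chosen n)))
    ... | no infinite = (λ n → e n , proj₁ (proj₂ (next n))) , e-independent
      where
      unspanned : ∀ vs → Independent vs → ∃ λ x → x ∈ X × ¬ Span vs x
      unspanned vs independent = byContradiction λ none → infinite
        (vs , independent , λ x x∈X → byContradiction λ x∉ → none (x , x∈X , x∉))
      open InfiniteDimensional unspanned

  -- Covering X by lines, and the cycle of implications

  module _ (X : Subset ≈ᴹ-setoid) where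

    open Lattice X

    -- The zero space contains no lines at all. A nonzero vector rules it out and gives a direction
    -- to the line through a point paired with itself.
    compacts⇒scatteredLines : (∃ λ v → ¬ v ≈ᴹ 0ᴹ) →
      OrderScatteredPoset S × ¬ HasJoinSubsemilattice S 𝒫<ω → CoveredByScatteredLines X
    compacts⇒scatteredLines (v₀ , v₀≉0) (scattered , no-𝒫<ω)
      with em {P = ∃ λ ls → ∀ x → x ∈ X → Any (x on-line_) ls}
    ... | yes (ls , cover) = ls , cover , All.universal (λ l → compactsScattered⇒traceScattered scattered) ls
    ... | no  uncovered =
      let x , independent = Greedy.convexlyIndependentSequence v₀ v₀≉0 X (λ ls cover → uncovered (ls , cover))
      in contradiction (independent⇒𝒫<ω X x independent) no-𝒫<ω

theorem5p1 :
    (∀ {ℓ} → ExcludedMiddle ℓ) →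
    ∀ {r ℓr m ℓm} (ℝ : Reals r ℓr) (V : Module (Reals.commutativeRing ℝ) m ℓm) →
    let open VectorSpace ℝ V in
    (∃ λ v → ¬ (v ≈ᴹ 0ᴹ)) →
    ∀ (X : Subset ≈ᴹ-setoid) →
    let L = Co X
        S = compactElements L
    in
    (TopScattered ⟦ X ⟧ (RelConvex X) ⇔ OrderScatteredPoset L) ×
    (OrderScatteredPoset L ⇔
      (OrderScatteredPoset S × ¬ HasJoinSubsemilattice S 𝒫<ω)) ×
    ((OrderScatteredPoset S × ¬ HasJoinSubsemilattice S 𝒫<ω) ⇔
      CoveredByScatteredLines X)
theorem5p1 em ℝ V nontrivial X =
    -- Each converse goes the rest of the way round the cycle.
    mk⇔ i⇒ii (iv⇒i ∘ iii⇒iv ∘ ii⇒iii)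
  , mk⇔ ii⇒iii (i⇒ii ∘ iv⇒i ∘ iii⇒iv)
  , mk⇔ iii⇒iv (ii⇒iii ∘ i⇒ii ∘ iv⇒i)
  where
  open Convexity em ℝ V
  open Lattice X
  i⇒ii = topScattered⇒orderScattered
  ii⇒iii = λ scattered →
    orderScattered⇒compactsScattered scattered , orderScattered⇒no-𝒫<ω scattered
  iii⇒iv = VectorSequences.compacts⇒scatteredLines em ℝ V X nontrivial
  iv⇒i = scatteredLines⇒topScattered
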